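{- There is a randomized algorithm that, given any two matroids $\mathcal{M}_1=(E,\mathcal{I}_1)$ and $\mathcal{M}_2=(E,\mathcal{I}_2)$ on the same ground set of $n$ elements, makes polynomially many independence queries per round and, with high probability, outputs a maximum common independent set of $\mathcal{M}_1$ and $\mathcal{M}_2$ (a set $S\in\mathcal{I}_1\cap\mathcal{I}_2$ of maximum cardinality) within $\widetilde{O}(n^{17/21})$ rounds.
   Context: Each matroid is accessed via an independence oracle which, for a queried $S\subseteq E$, reports whether $S$ is independent in that matroid. Computation proceeds in adaptive rounds; in each round polynomially many (in $n$) queries are submitted in parallel, and they may depend only on answers from earlier rounds and internal randomness. $\widetilde{O}(\cdot)$ hides polylogarithmic factors in $n$. -}

module Defs where

open import Data.Bool using (Bool; true; false; if_then_else_)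
open import Data.Nat using (ℕ; zero; suc; _*_; _^_; _∸_; _≤_; _<_)
open import Data.Fin using (Fin)
open import Data.Fin.Subset using (Subset; ⊥; ⁅_⁆; _∈_; _∉_; _⊆_; _∪_; ∣_∣)
open import Data.Vec using (Vec; map)
open import Data.List using (List; []; _∷ʳ_; length)
open import Data.List.Relation.Unary.All using (All)
open import Data.List.Relation.Unary.Unique.Propositional using (Unique)
open import Data.Product using (Σ; ∃; _×_; _,_)
open import Relation.Binary.PropositionalEquality using (_≡_)

record Matroid (n : ℕ) : Set where
  field
    indep      : Subset n → Bool
    indep-∅    : indep ⊥ ≡ true
    indep-⊆    : ∀ {A B} → A ⊆ B → indep B ≡ true → indep A ≡ true
    indep-exch : ∀ {A B} → indep A ≡ true → indep B ≡ true → ∣ A ∣ < ∣ B ∣ →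
                 ∃ λ x → x ∈ B × x ∉ A × indep (⁅ x ⁆ ∪ A) ≡ true
open Matroid public

Independent : ∀ {n} → Matroid n → Subset n → Set
Independent M S = indep M S ≡ true

IsMaxCommon : ∀ {n} → Matroid n → Matroid n → Subset n → Set
IsMaxCommon M₁ M₂ S =
  Independent M₁ S × Independent M₂ S ×
  (∀ T → Independent M₁ T → Independent M₂ T → ∣ T ∣ ≤ ∣ S ∣)

-- An adaptive, randomized query algorithm on ground set Fin n that submits
-- Q parallel queries per round and uses B random bits.  A query is a pair
-- (b , S): b = false asks M1 whether S is independent, b = true asks M2.
-- The queries of a round may depend on the random bits and on the answers
-- of all earlier rounds (the history list); the output likewise.
record RoundAlg (n Q B : ℕ) : Set where
  field
    queries : Vec Bool B → List (Vec Bool Q) → Vec (Bool × Subset n) Q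
    output  : Vec Bool B → List (Vec Bool Q) → Subset n
open RoundAlg public

ask : ∀ {n} → Matroid n → Matroid n → Bool × Subset n → Bool
ask M₁ M₂ (b , S) = if b then indep M₂ S else indep M₁ S

history : ∀ {n Q B} → RoundAlg n Q B → Matroid n → Matroid n →
          Vec Bool B → ℕ → List (Vec Bool Q)
history A M₁ M₂ r zero    = []
history A M₁ M₂ r (suc k) =
  history A M₁ M₂ r k ∷ʳ map (ask M₁ M₂) (queries A r (history A M₁ M₂ r k))

run : ∀ {n Q B} → RoundAlg n Q B → Matroid n → Matroid n →
      Vec Bool B → ℕ → Subset n
run A M₁ M₂ r R = output A r (history A M₁ M₂ r R)

-- With high probability (failure probability at most 1/n over the uniform
-- random string in {0,1}^B): at least a (1 - 1/n) fraction of the 2^B random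
-- strings lead to a maximum common independent set after R rounds.
SucceedsWHP : ∀ {n Q B} → RoundAlg n Q B → ℕ → Matroid n → Matroid n → Set
SucceedsWHP {n} {Q} {B} A R M₁ M₂ =
  ∃ λ (good : List (Vec Bool B)) →
    Unique good ×
    All (λ r → IsMaxCommon M₁ M₂ (run A M₁ M₂ r R)) good ×
    (n ∸ 1) * 2 ^ B ≤ n * length good

{-# OPTIONS --safe #-}

-- Each element e carries weights with w₁ e + w₂ e ∈ {L , L + 1}; S₁ and S₂ ⊆ S₁ are
-- maximum-weight independent sets of M₁ and M₂.  As long as |S₁ ─ S₂| ≥ δ, a batch of δ
-- elements of S₁ ─ S₂ bids: the weights of the batch are raised in M₂ or lowered in M₁.
-- Every bid increases Σ (w₂ + L - w₁) ≤ 2nL by one, so there are at most 2nL/δ batches,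
-- and comparing dual values shows that at the end S₂ misses at most n/L + δ elements of
-- a maximum common independent set.  These are supplied by augmenting paths, each of
-- which costs one round since the whole exchange graph is queried at once.
--
-- After a batch the new maximum-weight sets differ from a known independent set by at
-- most δ elements.  All prefixes of the greedy order are completed in parallel, and one
-- completion takes O(√δ log n) rounds: in each round the candidates are scanned in runs
-- of at most √δ elements, and either some run is independent and is added entirely, or
-- every run contains a spanned candidate that is deleted.
--
-- With t ≈ n^(1/5), L = t and δ = t⁴ the total is O(t⁴ log n) = O(n^(4/5) log n) rounds,
-- without any use of randomness.
module Submission where

open import Defs
open import Data.Bool using (Bool; true; false; if_then_else_; not; _∧_; _xor_)
open import Data.Bool.Properties using () renaming (_≟_ to _≟ᵇ_)
open import Data.Empty using (⊥-elim)
open import Data.Fin using (Fin; zero; suc; toℕ; combine; fromℕ<) renaming (_<_ to _<ᶠ_)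
open import Data.Fin.Properties
  using (any?; toℕ<n; toℕ-injective; toℕ-fromℕ<; combine-injective; combine-monoˡ-<)
  renaming (_≟_ to _≟ᶠ_)
open import Data.Fin.Subset
  using (Subset; ⊥; ⊤; ⁅_⁆; _∈_; _∉_; _⊆_; _∪_; _∩_; _─_; _-_; ∁; ∣_∣)
open import Data.Fin.Subset.Properties
open import Data.List
  using (List; []; _∷_; _++_; length; map; filter; allFin; take; drop; _∷ʳ_)
open import Data.List.Membership.Propositional using () renaming (_∈_ to _∈ᴸ_)
open import Data.List.Membership.Propositional.Properties
  using (∈-filter⁺; ∈-filter⁻; ∈-allFin; ∈-map⁺; ∈-++⁺ˡ; ∈-++⁺ʳ)
open import Data.List.Properties using (length-map; length-++; map-++; length-filter; length-tabulate)
open import Data.List.Relation.Unary.All as All using (All; []; _∷_)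
open import Data.List.Relation.Unary.All.Properties using (All¬⇒¬Any; ¬Any⇒All¬)
open import Data.List.Relation.Unary.AllPairs as AllPairs using (AllPairs; []; _∷_)
open import Data.List.Relation.Unary.Any as Any using (Any; here; there)
open import Data.Nat
  using (ℕ; zero; suc; _+_; _*_; _^_; _∸_; _≤_; _<_; z≤n; s≤s; s≤s⁻¹; nonZero; >-nonZero; _⊓_; _≤?_; _<?_; _≟_)
open import Data.Nat.Logarithm using (⌊log₂_⌋; ⌊log₂⌋-mono-≤; ⌊log₂[2^n]⌋≡n)
open import Data.Nat.Properties hiding (_≟_; _≤?_; _<?_)
open import Data.Product using (Σ; ∃; ∃₂; _×_; _,_; proj₁; proj₂)
open import Data.Product.Properties using () renaming (≡-dec to ×-≡-dec)
open import Data.Sum using (_⊎_; inj₁; inj₂; [_,_]′)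
open import Data.Vec as Vec using (Vec; []; _∷_; tabulate; lookup; here; there)
open import Data.Vec.Properties as Vecₚ
  using ([]=⇒lookup; lookup⇒[]=; lookup∘tabulate; tabulate-cong)
open import Function using (_∘_; id; case_of_)
open import Relation.Binary.PropositionalEquality
  using (_≡_; _≢_; refl; sym; trans; cong; cong₂; subst; module ≡-Reasoning)
open import Relation.Nullary using (¬_; Dec; yes; no; does; contradiction)
open import Relation.Nullary.Decidable
  using (_×-dec_; _⊎-dec_; ¬?; dec-true; dec-false; decidable-stable)

-- The obstacle is that a maximum-weight basis is normally built one greedy decision after another.
-- Whether an element is selected depends only on the span of its predecessors, and any basis of
-- that span serves for the test, so the decisions can be taken independently of each other. What
-- remains is to complete a basis, which is cheap if the known independent set falls short by few
-- elements. Bidding provides such a set: for M₂ the part of the old `S₂` in the prefix, for M₁ the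
-- set `S₁` without the lowered bidders, which can be kept even though its light elements precede
-- the greedy choice. A bidder with sum `L` is raised in M₂ and one with sum `L + 1` is lowered in
-- M₁; this keeps the sums in their range and preserves `S₂ ⊆ S₁`. The parameters equate, up to
-- logarithms, the three costs nL/√δ for the batches and n/L and δ for the augmentations.

private variable
  n : ℕ

-- Finite subsets and matroids

∈-insert : ∀ {x : Fin n} {A} → x ∈ ⁅ x ⁆ ∪ A
∈-insert {x = x} {A} = p⊆p∪q A (x∈⁅x⁆ x)

⊆-insert : ∀ {x : Fin n} {A} → A ⊆ ⁅ x ⁆ ∪ A
⊆-insert {x = x} {A} = q⊆p∪q ⁅ x ⁆ A

∈-insert⁻ : ∀ {x y : Fin n} {A} → y ∈ ⁅ x ⁆ ∪ A → y ≡ x ⊎ y ∈ A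
∈-insert⁻ {x = x} {A = A} p with x∈p∪q⁻ ⁅ x ⁆ A p
... | inj₁ q = inj₁ (x∈⁅y⁆⇒x≡y x q)
... | inj₂ q = inj₂ q

insert-⊆ : ∀ {x : Fin n} {A B} → x ∈ B → A ⊆ B → ⁅ x ⁆ ∪ A ⊆ B
insert-⊆ {B = B} x∈B A⊆B p with ∈-insert⁻ p
... | inj₁ y≡x = subst (_∈ B) (sym y≡x) x∈B
... | inj₂ q = A⊆B q

insert-mono : ∀ {x : Fin n} {A B} → A ⊆ B → ⁅ x ⁆ ∪ A ⊆ ⁅ x ⁆ ∪ B
insert-mono A⊆B = insert-⊆ ∈-insert (⊆-insert ∘ A⊆B)

∪-⊆ : ∀ {A B C : Subset n} → A ⊆ C → B ⊆ C → A ∪ B ⊆ C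
∪-⊆ {A = A} {B} f g p = [ f , g ]′ (x∈p∪q⁻ A B p)

∈-∪ˡ : ∀ {A : Subset n} B → A ⊆ A ∪ B
∈-∪ˡ B = p⊆p∪q B

∈-∪ʳ : ∀ A {B : Subset n} → B ⊆ A ∪ B
∈-∪ʳ A {B} = q⊆p∪q A B

∈-─⁻ : ∀ {x : Fin n} A B → x ∈ A ─ B → x ∈ A × x ∉ B
∈-─⁻ A B p = p─q⊆p A B p , ∉-diff A B p
  where
  ∉-diff : ∀ {m} {x : Fin m} A B → x ∈ A ─ B → x ∉ B
  ∉-diff (_ ∷ A) (true ∷ B) (there p) (there q) = ∉-diff A B p q
  ∉-diff (_ ∷ A) (false ∷ B) (there p) (there q) = ∉-diff A B p q

∈-remove⁻ : ∀ {x y : Fin n} A → x ∈ A - y → x ∈ A × x ≢ y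
∈-remove⁻ {y = y} A p with ∈-─⁻ A ⁅ y ⁆ p
... | q , r = q , λ { refl → r (x∈⁅x⁆ y) }

⟨_⟩ : {P : Fin n → Set} → (∀ x → Dec (P x)) → Subset n
⟨ P? ⟩ = tabulate (does ∘ P?)

∈⟨⟩⁺ : ∀ {P : Fin n → Set} (P? : ∀ x → Dec (P x)) {x} → P x → x ∈ ⟨ P? ⟩
∈⟨⟩⁺ P? {x} p = lookup⇒[]= x _ (trans (lookup∘tabulate _ x) (dec-true (P? x) p))

∈⟨⟩⁻ : ∀ {P : Fin n → Set} (P? : ∀ x → Dec (P x)) {x} → x ∈ ⟨ P? ⟩ → P x
∈⟨⟩⁻ P? {x} p with trans (sym (lookup∘tabulate (does ∘ P?) x)) ([]=⇒lookup p)
... | q with P? x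
... | yes r = r
... | no _ = case q of λ ()

∣insert∣ : ∀ {x : Fin n} {A} → x ∉ A → ∣ ⁅ x ⁆ ∪ A ∣ ≡ suc ∣ A ∣
∣insert∣ {x = zero} {true ∷ A} x∉A = ⊥-elim (x∉A here)
∣insert∣ {x = zero} {false ∷ A} x∉A = cong (suc ∘ ∣_∣) (∪-identityˡ A)
∣insert∣ {x = suc x} {true ∷ A} x∉A = cong suc (∣insert∣ (x∉A ∘ there))
∣insert∣ {x = suc x} {false ∷ A} x∉A = ∣insert∣ (x∉A ∘ there)

∣split∣ : ∀ (A U : Subset n) → ∣ A ∣ ≡ ∣ A ∩ U ∣ + ∣ A ─ U ∣
∣split∣ [] [] = refl
∣split∣ (false ∷ A) (false ∷ U) = ∣split∣ A U
∣split∣ (false ∷ A) (true ∷ U) = ∣split∣ A U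
∣split∣ (true ∷ A) (false ∷ U) = trans (cong suc (∣split∣ A U)) (sym (+-suc _ _))
∣split∣ (true ∷ A) (true ∷ U) = cong suc (∣split∣ A U)

⊆-card⇒⊇ : ∀ {A B : Subset n} → A ⊆ B → ∣ B ∣ ≤ ∣ A ∣ → B ⊆ A
⊆-card⇒⊇ {A = A} {B} A⊆B ∣B∣≤∣A∣ {x} x∈B with x ∈? A
... | yes x∈A = x∈A
... | no x∉A = contradiction (p⊂q⇒∣p∣<∣q∣ (A⊆B , x , x∈B , x∉A)) (≤⇒≯ ∣B∣≤∣A∣)

-- A - y + x
swap : Fin n × Fin n → Subset n → Subset n
swap (y , x) A = ⁅ x ⁆ ∪ (A - y)

∣remove∣ : ∀ {y : Fin n} {A} → y ∈ A → suc ∣ A - y ∣ ≡ ∣ A ∣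
∣remove∣ {y = y} {A} y∈A = trans (sym (∣insert∣ λ p → proj₂ (∈-remove⁻ A p) refl))
  (≤-antisym (p⊆q⇒∣p∣≤∣q∣ (insert-⊆ y∈A (p─q⊆p A _)))
             (p⊆q⇒∣p∣≤∣q∣ A⊆))
  where
  A⊆ : A ⊆ ⁅ y ⁆ ∪ (A - y)
  A⊆ {z} z∈A with z ≟ᶠ y
  ... | yes refl = ∈-insert
  ... | no z≢y = ⊆-insert (x∈p∧x≢y⇒x∈p-y z∈A z≢y)

∣swap∣ : ∀ {x y : Fin n} {A} → x ∉ A → y ∈ A → ∣ swap (y , x) A ∣ ≡ ∣ A ∣
∣swap∣ {A = A} x∉A y∈A = trans (∣insert∣ (x∉A ∘ p─q⊆p A _)) (∣remove∣ y∈A)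

-- Bases, span and fundamental circuits

module _ (M : Matroid n) where

  independent? : ∀ A → Dec (Independent M A)
  independent? A = indep M A ≟ᵇ true

  dependent-⊇ : ∀ {A B} → A ⊆ B → ¬ Independent M A → ¬ Independent M B
  dependent-⊇ A⊆B ¬A B = ¬A (indep-⊆ M A⊆B B)

  record IsBasis (X B : Subset n) : Set where
    constructor basis
    field
      within      : B ⊆ X
      independent : Independent M B
      maximal     : ∀ {x} → x ∈ X → x ∉ B → ¬ Independent M (⁅ x ⁆ ∪ B)
  open IsBasis public

  basis-largest : ∀ {X B J} → IsBasis X B → Independent M J → J ⊆ X → ∣ J ∣ ≤ ∣ B ∣
  basis-largest β indJ J⊆X = ≮⇒≥ λ lt →
    let x , x∈J , x∉B , ind = indep-exch M (independent β) indJ lt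
    in maximal β (J⊆X x∈J) x∉B ind

  largest-basis : ∀ {X B} → B ⊆ X → Independent M B →
                  (∀ {J} → Independent M J → J ⊆ X → ∣ J ∣ ≤ ∣ B ∣) → IsBasis X B
  largest-basis B⊆X indB max = basis B⊆X indB λ x∈X x∉B ind →
    1+n≰n (subst (_≤ _) (∣insert∣ x∉B) (max ind (insert-⊆ x∈X B⊆X)))

  extend : ∀ {I X} → Independent M I → I ⊆ X → ∃ λ B → I ⊆ B × IsBasis X B
  extend {I} {X} indI I⊆X = go n indI I⊆X (m≤n+m n ∣ I ∣)
    where
    go : ∀ k {I} → Independent M I → I ⊆ X → n ≤ ∣ I ∣ + k → ∃ λ B → I ⊆ B × IsBasis X B
    go k {I} ind I⊆X n≤
      with any? (λ x → (x ∈? X) ×-dec (¬? (x ∈? I) ×-dec independent? (⁅ x ⁆ ∪ I)))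
    ... | no ¬ext = I , id , basis I⊆X ind λ x∈X x∉I i → ¬ext (_ , x∈X , x∉I , i)
    go zero {I} ind I⊆X n≤ | yes (x , x∈X , x∉I , i) =
      contradiction (subst (_≤ n) (∣insert∣ x∉I) (∣p∣≤n (⁅ x ⁆ ∪ I)))
        (<⇒≱ (s≤s (subst (n ≤_) (+-identityʳ _) n≤)))
    go (suc k) {I} ind I⊆X n≤ | yes (x , x∈X , x∉I , i)
      with go k i (insert-⊆ x∈X I⊆X)
             (subst (n ≤_) (trans (+-suc _ k) (cong (_+ k) (sym (∣insert∣ x∉I)))) n≤)
    ... | B , ⊆B , β = B , ⊆B ∘ ⊆-insert , β

  basis-insert : ∀ {X B x} → IsBasis X B → Independent M (⁅ x ⁆ ∪ B) → IsBasis (⁅ x ⁆ ∪ X) (⁅ x ⁆ ∪ B)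
  basis-insert {x = x} β ind = basis (insert-mono (within β)) ind λ y∈ y∉ → case ∈-insert⁻ y∈ of λ where
    (inj₁ refl) → ⊥-elim (y∉ ∈-insert)
    (inj₂ y∈X) → dependent-⊇ (insert-mono ⊆-insert) (maximal β y∈X (y∉ ∘ ⊆-insert))

  -- Extend `I` to a basis `C` of `X`. As `x` depends on `I`, `C` is also a basis of `X` with `x`
  -- added, so an independent set `⁅ x ⁆ ∪ B` would be larger than `C`, while `B` and `C` have the
  -- same size.
  basis-spanned : ∀ {I X B x} → Independent M I → I ⊆ X → (x ∈ I ⊎ ¬ Independent M (⁅ x ⁆ ∪ I)) →
                  IsBasis X B → IsBasis (⁅ x ⁆ ∪ X) B
  basis-spanned {I} {X} {B} {x} indI I⊆X dead β = basis (⊆-insert ∘ within β) (independent β) λ where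
      y∈ y∉B ind → case ∈-insert⁻ y∈ of λ where
        (inj₂ y∈X) → maximal β y∈X y∉B ind
        (inj₁ refl) → x-dead dead y∉B ind
    where
    x-dead : (x ∈ I ⊎ ¬ Independent M (⁅ x ⁆ ∪ I)) → x ∉ B → ¬ Independent M (⁅ x ⁆ ∪ B)
    x-dead (inj₁ x∈I) x∉B ind = maximal β (I⊆X x∈I) x∉B ind
    x-dead (inj₂ dep) x∉B ind with extend indI I⊆X
    ... | C , I⊆C , γ = 1+n≰n (≤-trans (subst (_≤ ∣ C ∣) (∣insert∣ x∉B) (basis-largest γ′ ind (insert-mono (within β))))
                                       (basis-largest β (independent γ) (within γ)))
      where
      γ′ : IsBasis (⁅ x ⁆ ∪ X) C
      γ′ = basis (⊆-insert ∘ within γ) (independent γ) λ y∈ y∉C → case ∈-insert⁻ y∈ of λ where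
        (inj₁ refl) → dependent-⊇ (insert-mono I⊆C) dep
        (inj₂ y∈X) → maximal γ y∈X y∉C

  -- This makes greedy decisions independent of each other: every basis of the predecessors gives
  -- the same answer.
  spanned-unique : ∀ {X B C x} → IsBasis X B → IsBasis X C → x ∉ C →
                   ¬ Independent M (⁅ x ⁆ ∪ B) → ¬ Independent M (⁅ x ⁆ ∪ C)
  spanned-unique β γ x∉C dep ind =
    maximal (basis-spanned (independent β) (within β) (inj₂ dep) γ) ∈-insert x∉C ind

  -- The part of S outside U is independent over the span of S ∩ U.
  independent-replace : ∀ {S U J} → Independent M S → IsBasis U (S ∩ U) →
                        Independent M J → J ⊆ U → Independent M (J ∪ (S ─ U))
  independent-replace {S} {U} {J} indS β indJ J⊆U with extend indJ (∈-∪ˡ {A = J} S)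
  ... | B , J⊆B , γ = indep-⊆ M (∪-⊆ J⊆B (p─q⊆p B U ∘ ⊆-card⇒⊇ B─U⊆S─U card)) (independent γ)
    where
    B─U⊆S─U : B ─ U ⊆ S ─ U
    B─U⊆S─U p with ∈-─⁻ B U p
    ... | x∈B , x∉U with x∈p∪q⁻ J S (within γ x∈B)
    ... | inj₁ x∈J = ⊥-elim (x∉U (J⊆U x∈J))
    ... | inj₂ x∈S = x∈p∧x∉q⇒x∈p─q x∈S x∉U

    -- `B` is at least as large as `S`, but inside `U` it has at most `∣ S ∩ U ∣` elements, so
    -- outside `U` it must use all of `S ─ U`.
    card : ∣ S ─ U ∣ ≤ ∣ B ─ U ∣
    card = +-cancelˡ-≤ ∣ S ∩ U ∣ _ _ (begin
      ∣ S ∩ U ∣ + ∣ S ─ U ∣ ≡⟨ ∣split∣ S U ⟨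
      ∣ S ∣                 ≤⟨ basis-largest γ indS (∈-∪ʳ J) ⟩
      ∣ B ∣                 ≡⟨ ∣split∣ B U ⟩
      ∣ B ∩ U ∣ + ∣ B ─ U ∣ ≤⟨ +-monoˡ-≤ _ (basis-largest β (indep-⊆ M (p∩q⊆p B U) (independent γ)) (p∩q⊆q B U)) ⟩
      ∣ S ∩ U ∣ + ∣ B ─ U ∣ ∎)
      where open ≤-Reasoning

  -- If x lies in the span of S and no element of S ─ Z can be exchanged for x,
  -- then the fundamental circuit of x is contained in Z + x.
  spanned-by : ∀ {S Z x} → Independent M S → x ∉ S → Z ⊆ S → ¬ Independent M (⁅ x ⁆ ∪ S) →
               (∀ {y} → y ∈ S → y ∉ Z → ¬ Independent M (swap (y , x) S)) → ¬ Independent M (⁅ x ⁆ ∪ Z)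
  spanned-by {S} {Z} {x} indS x∉S Z⊆S dep fixed ind
    with extend ind (insert-mono Z⊆S)
  ... | B , Z⊆B , β with any? (λ y → (y ∈? S) ×-dec ¬? (y ∈? B))
  ... | no none = dependent-⊇ (insert-⊆ (Z⊆B ∈-insert)
          (λ {y} y∈S → decidable-stable (y ∈? B) λ y∉B → none (y , y∈S , y∉B))) dep (independent β)
  -- `B` lies in `swap (y , x) S` and has at least the size of `S`, hence equals that set, and `y`
  -- could be exchanged for `x`.
  ... | yes (y , y∈S , y∉B) = fixed y∈S (y∉B ∘ Z⊆B ∘ ⊆-insert) (indep-⊆ M (⊆-card⇒⊇ B⊆ card) (independent β))
    where
    B⊆ : B ⊆ swap (y , x) S
    B⊆ z∈B with ∈-insert⁻ (within β z∈B)
    ... | inj₁ refl = ∈-insert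
    ... | inj₂ z∈S = ⊆-insert (x∈p∧x≢y⇒x∈p-y z∈S λ { refl → y∉B z∈B })

    card : ∣ swap (y , x) S ∣ ≤ ∣ B ∣
    card = subst (_≤ ∣ B ∣) (sym (∣swap∣ x∉S y∈S)) (basis-largest β indS ⊆-insert)

-- Greedy bases and level sets

record PriorityKey (w : Fin n → ℕ) : Set where
  field
    key           : Fin n → ℕ
    bound         : ℕ
    key-bounded   : ∀ x → key x < bound
    key-injective : ∀ {x y} → key x ≡ key y → x ≡ y
    key-antitone  : ∀ {x y} → key x < key y → w y ≤ w x

  key-antitone-≤ : ∀ {x y} → key x ≤ key y → w y ≤ w x
  key-antitone-≤ {x} {y} p with m≤n⇒m<n∨m≡n p
  ... | inj₁ q = key-antitone q
  ... | inj₂ q = ≤-reflexive (cong w (sym (key-injective q)))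

-- Lexicographic order by decreasing weight, then by index. Ties are broken so that each key adds at
-- most one element to a prefix.
priorityKey : ∀ L (w : Fin n → ℕ) → (∀ x → w x ≤ L) → PriorityKey w
priorityKey {n} L w w≤L = record
  { key = λ x → toℕ (code x)
  ; bound = suc L * n
  ; key-bounded = λ x → toℕ<n (code x)
  ; key-injective = λ {x} {y} p → proj₂ (combine-injective (rank x) x (rank y) y (toℕ-injective p))
  ; key-antitone = λ {x} {y} p → ≮⇒≥ λ lt → <-asym p (combine-monoˡ-< y x (rank-antitone lt))
  }
  where
  rank : Fin n → Fin (suc L)
  rank x = fromℕ< (s≤s (m∸n≤m L (w x)))
  code : Fin n → Fin (suc L * n)
  code x = combine (rank x) x
  rank-antitone : ∀ {x y} → w x < w y → rank y <ᶠ rank x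
  rank-antitone {x} {y} lt = subst (_< toℕ (rank x)) (sym (toℕ-fromℕ< _))
    (subst (L ∸ w y <_) (sym (toℕ-fromℕ< _)) (∸-monoʳ-< lt (w≤L y)))

level : (Fin n → ℕ) → ℕ → Subset n
level w j = ⟨ (λ x → j ≤? w x) ⟩

∈-level⁺ : ∀ (w : Fin n → ℕ) {j x} → j ≤ w x → x ∈ level w j
∈-level⁺ w {j} = ∈⟨⟩⁺ (λ x → j ≤? w x)

∈-level⁻ : ∀ (w : Fin n → ℕ) {j x} → x ∈ level w j → j ≤ w x
∈-level⁻ w {j} = ∈⟨⟩⁻ (λ x → j ≤? w x)

module _ (V : Subset n) {w : Fin n → ℕ} (K : PriorityKey w) where
  open PriorityKey K

  before : ℕ → Subset n
  before k = ⟨ (λ x → (x ∈? V) ×-dec (key x <? k)) ⟩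

  ∈-before⁺ : ∀ {k x} → x ∈ V → key x < k → x ∈ before k
  ∈-before⁺ {k} x∈V lt = ∈⟨⟩⁺ (λ x → (x ∈? V) ×-dec (key x <? k)) (x∈V , lt)

  ∈-before⁻ : ∀ {k x} → x ∈ before k → x ∈ V × key x < k
  ∈-before⁻ {k} = ∈⟨⟩⁻ (λ x → (x ∈? V) ×-dec (key x <? k))

  before-zero : before 0 ≡ ⊥
  before-zero = ⊆-antisym (λ p → case proj₂ (∈-before⁻ {0} p) of λ ()) (λ p → ⊥-elim (∉⊥ p))

  before-skip : ∀ {k} → (∀ x → x ∈ V → key x ≢ k) → before (suc k) ≡ before k
  before-skip none = ⊆-antisym
    (λ p → let x∈V , lt = ∈-before⁻ p in ∈-before⁺ x∈V (≤∧≢⇒< (s≤s⁻¹ lt) (none _ x∈V)))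
    (λ p → let x∈V , lt = ∈-before⁻ p in ∈-before⁺ x∈V (m<n⇒m<1+n lt))

  before-step : ∀ {x} → x ∈ V → before (suc (key x)) ≡ ⁅ x ⁆ ∪ before (key x)
  before-step {x} x∈V = ⊆-antisym
    (λ p → let y∈V , lt = ∈-before⁻ p in case m≤n⇒m<n∨m≡n (s≤s⁻¹ lt) of λ where
      (inj₁ lt′) → ⊆-insert (∈-before⁺ y∈V lt′)
      (inj₂ eq) → subst (_∈ ⁅ x ⁆ ∪ before (key x)) (sym (key-injective eq)) ∈-insert)
    (insert-⊆ (∈-before⁺ x∈V ≤-refl)
      (λ p → let y∈V , lt = ∈-before⁻ p in ∈-before⁺ y∈V (m<n⇒m<1+n lt)))

  module _ (M : Matroid n) where

    -- G consists of the elements of V that are not spanned by A and their predecessors;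
    -- B is an arbitrary basis of that span.
    record IsGreedy (A G : Subset n) : Set where
      field
        selected-⊆ : G ⊆ V
        selects    : ∀ {x} → x ∈ V → ∃ λ B → IsBasis M (A ∪ before (key x)) B ×
                     (x ∈ G → Independent M (⁅ x ⁆ ∪ B)) × (x ∉ G → ¬ Independent M (⁅ x ⁆ ∪ B))

    module _ {A G : Subset n} (indA : Independent M A) (disjoint : ∀ {x} → x ∈ V → x ∉ A)
             (greedy : IsGreedy A G) where
      open IsGreedy greedy

      private
        chosen : ℕ → Subset n
        chosen k = A ∪ (G ∩ before k)

        chosen-in : ∀ {x} → x ∈ V → x ∈ G → chosen (suc (key x)) ≡ ⁅ x ⁆ ∪ chosen (key x)
        chosen-in {x} x∈V x∈G rewrite before-step x∈V = ⊆-antisym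
          (∪-⊆ (⊆-insert ∘ ∈-∪ˡ _) (λ p → let p₁ , p₂ = x∈p∩q⁻ G _ p in case ∈-insert⁻ p₂ of λ where
            (inj₁ refl) → ∈-insert
            (inj₂ q) → ⊆-insert (∈-∪ʳ A (x∈p∩q⁺ (p₁ , q)))))
          (insert-⊆ (∈-∪ʳ A (x∈p∩q⁺ (x∈G , ∈-insert)))
            (∪-⊆ (∈-∪ˡ _) (λ p → let p₁ , p₂ = x∈p∩q⁻ G _ p in ∈-∪ʳ A (x∈p∩q⁺ (p₁ , ⊆-insert p₂)))))

        chosen-out : ∀ {x} → x ∈ V → x ∉ G → chosen (suc (key x)) ≡ chosen (key x)
        chosen-out {x} x∈V x∉G rewrite before-step x∈V = ⊆-antisym
          (∪-⊆ (∈-∪ˡ _) (λ p → let p₁ , p₂ = x∈p∩q⁻ G _ p in case ∈-insert⁻ p₂ of λ where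
            (inj₁ refl) → ⊥-elim (x∉G p₁)
            (inj₂ q) → ∈-∪ʳ A (x∈p∩q⁺ (p₁ , q))))
          (∪-⊆ (∈-∪ˡ _) (λ p → let p₁ , p₂ = x∈p∩q⁻ G _ p in ∈-∪ʳ A (x∈p∩q⁺ (p₁ , ⊆-insert p₂))))

        insert-∪ : ∀ {x} {Q : Subset n} → A ∪ (⁅ x ⁆ ∪ Q) ≡ ⁅ x ⁆ ∪ (A ∪ Q)
        insert-∪ {x} {Q} = ⊆-antisym
          (∪-⊆ (⊆-insert ∘ ∈-∪ˡ Q) (insert-mono (∈-∪ʳ A)))
          (insert-⊆ (∈-∪ʳ A ∈-insert) (∪-⊆ (∈-∪ˡ _) (∈-∪ʳ A ∘ ⊆-insert)))

      -- Induction along the keys: an unspanned element enlarges the current basis, a spanned one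
      -- leaves it a basis of the longer prefix. The test was made with an unrelated basis `B`, and
      -- `spanned-unique` transfers its outcome.
      greedy-basis : ∀ k → IsBasis M (A ∪ before k) (A ∪ (G ∩ before k))
      greedy-basis zero rewrite before-zero | ∩-zeroʳ G | ∪-identityʳ A =
        basis id indA (λ p q → ⊥-elim (q p))
      greedy-basis (suc k) with greedy-basis k | any? (λ x → (x ∈? V) ×-dec (key x ≟ k))
      ... | β | no none rewrite before-skip (λ x x∈V eq → none (x , x∈V , eq)) = β
      ... | β | yes (x , x∈V , refl) with selects x∈V | x ∈? G
      ... | B , γ , in⇒ , out⇒ | yes x∈G
        rewrite chosen-in x∈V x∈G | before-step x∈V | insert-∪ {x} {before (key x)} =
        basis-insert M β (decidable-stable (independent? M _)
          λ dep → spanned-unique M β γ x∉B dep (in⇒ x∈G))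
        where
        x∉B : x ∉ B
        x∉B x∈B with x∈p∪q⁻ A _ (within γ x∈B)
        ... | inj₁ p = disjoint x∈V p
        ... | inj₂ p = n≮n _ (proj₂ (∈-before⁻ p))
      ... | B , γ , in⇒ , out⇒ | no x∉G
        rewrite chosen-out x∈V x∉G | before-step x∈V | insert-∪ {x} {before (key x)} =
        basis-spanned M (independent β) (within β) (inj₂ (spanned-unique M γ β x∉ (out⇒ x∉G))) β
        where
        x∉ : x ∉ A ∪ (G ∩ before (key x))
        x∉ p with x∈p∪q⁻ A _ p
        ... | inj₁ q = disjoint x∈V q
        ... | inj₂ q = x∉G (p∩q⊆p G _ q)

      greedy-independent : Independent M (A ∪ G)
      greedy-independent = indep-⊆ M
        (∪-⊆ (∈-∪ˡ _) (λ x∈G → ∈-∪ʳ A (x∈p∩q⁺ (x∈G , ∈-before⁺ (selected-⊆ x∈G) (key-bounded _)))))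
        (independent (greedy-basis bound))

      greedy-spanned : ∀ {x} → x ∈ V → x ∉ G →
        ¬ Independent M (⁅ x ⁆ ∪ (A ∪ (G ∩ before (suc (key x)))))
      greedy-spanned {x} x∈V x∉G = maximal (greedy-basis (suc (key x)))
        (∈-∪ʳ A (∈-before⁺ x∈V ≤-refl))
        λ p → case x∈p∪q⁻ A _ p of λ where
          (inj₁ q) → disjoint x∈V q
          (inj₂ q) → x∉G (p∩q⊆p G _ q)

-- Maximum-weight independent sets under changes of the weights

module _ (M : Matroid n) where

  -- S is a maximum-weight independent set for w: it spans every level set {w ≥ j}, j ≥ 1.
  record LevelBasis (w : Fin n → ℕ) (S : Subset n) : Set where
    field
      level-independent : Independent M S
      positive          : ∀ {x} → x ∈ S → 1 ≤ w x
      spanning          : ∀ {x} → x ∉ S → 1 ≤ w x → ¬ Independent M (⁅ x ⁆ ∪ (S ∩ level w (w x)))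
  open LevelBasis public

  -- An element heavier than `j` is already spanned within its own level set, which is contained in
  -- the one for `j`.
  level-basis : ∀ {w S} → LevelBasis w S → ∀ {j} → 1 ≤ j → IsBasis M (level w j) (S ∩ level w j)
  level-basis {w} {S} lb 1≤j = basis (p∩q⊆q S _) (indep-⊆ M (p∩q⊆p S _) (level-independent lb)) λ {x} x∈U x∉ →
    let j≤wx = ∈-level⁻ w x∈U in
    dependent-⊇ M (insert-mono λ p → let p₁ , p₂ = x∈p∩q⁻ S _ p in
                     x∈p∩q⁺ (p₁ , ∈-level⁺ w (≤-trans j≤wx (∈-level⁻ w p₂))))
      (spanning lb (λ x∈S → x∉ (x∈p∩q⁺ (x∈S , x∈U))) (≤-trans 1≤j j≤wx))

  -- Selecting over the fixed set `S ─ D` ignores that some of its elements are lighter than the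
  -- competitors. This does no harm, because the part of `S` below a level is independent over the
  -- span of that level.
  lower-level-basis : ∀ {w w′ S D G} → LevelBasis w S → D ⊆ S →
    (∀ {x} → x ∈ D → suc (w′ x) ≡ w x) → (∀ {x} → x ∉ D → w′ x ≡ w x) →
    (K : PriorityKey w′) →
    IsGreedy ⟨ (λ x → ¬? (x ∈? (S ─ D)) ×-dec (1 ≤? w′ x)) ⟩ K M (S ─ D) G →
    LevelBasis w′ ((S ─ D) ∪ G)
  lower-level-basis {w} {w′} {S} {D} {G} lb D⊆S on off K greedy = record
    { level-independent = greedy-independent V K M indA disjoint greedy
    ; positive = λ p → case x∈p∪q⁻ A G p of λ where
        (inj₁ q) → let x∈S , x∉D = ∈-─⁻ S D q in subst (1 ≤_) (sym (off x∉D)) (positive lb x∈S)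
        (inj₂ q) → proj₂ (∈⟨⟩⁻ V? (IsGreedy.selected-⊆ greedy q))
    ; spanning = spanning′
    }
    where
    A = S ─ D
    V? = λ x → ¬? (x ∈? A) ×-dec (1 ≤? w′ x)
    V = ⟨ V? ⟩
    open PriorityKey K

    disjoint : ∀ {x} → x ∈ V → x ∉ A
    disjoint p = proj₁ (∈⟨⟩⁻ V? p)

    indA : Independent M A
    indA = indep-⊆ M (p─q⊆p S D) (level-independent lb)

    w′≤w : ∀ x → w′ x ≤ w x
    w′≤w x with x ∈? D
    ... | yes x∈D = subst (w′ x ≤_) (on x∈D) (n≤1+n _)
    ... | no x∉D = ≤-reflexive (off x∉D)

    spanning′ : ∀ {x} → x ∉ A ∪ G → 1 ≤ w′ x → ¬ Independent M (⁅ x ⁆ ∪ ((A ∪ G) ∩ level w′ (w′ x)))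
    -- `U` is a level set of the old weights, so `S ∩ U` is a basis of it. If `J` were independent,
    -- then so would be `J ∪ (S ─ U)`, which contains `x`, all of `A` and everything selected before
    -- `x`.
    spanning′ {x} x∉ 1≤ ind = greedy-spanned V K M indA disjoint greedy x∈V (x∉ ∘ ∈-∪ʳ A)
        (indep-⊆ M cover (independent-replace M (level-independent lb) β ind J⊆U))
      where
      x∈V : x ∈ V
      x∈V = ∈⟨⟩⁺ V? (x∉ ∘ ∈-∪ˡ G , 1≤)
      U = level w (w′ x)
      β : IsBasis M U (S ∩ U)
      β = level-basis lb 1≤
      J = ⁅ x ⁆ ∪ ((A ∪ G) ∩ level w′ (w′ x))
      J⊆U : J ⊆ U
      J⊆U = insert-⊆ (∈-level⁺ w (w′≤w x)) λ p →
        ∈-level⁺ w {w′ x} (≤-trans (∈-level⁻ w′ {w′ x} (p∩q⊆q _ _ p)) (w′≤w _))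
      J∪ = J ∪ (S ─ U)
      cover : ⁅ x ⁆ ∪ (A ∪ (G ∩ before V K (suc (key x)))) ⊆ J∪
      cover = insert-⊆ (∈-∪ˡ _ ∈-insert) (∪-⊆ coverA coverG)
        where
        coverA : A ⊆ J∪
        coverA {y} y∈A with ∈-─⁻ S D y∈A | y ∈? U
        ... | y∈S , y∉D | yes y∈U = ∈-∪ˡ _ (⊆-insert (x∈p∩q⁺ (∈-∪ˡ G y∈A ,
                ∈-level⁺ w′ (subst (w′ x ≤_) (sym (off y∉D)) (∈-level⁻ w y∈U)))))
        ... | y∈S , _ | no y∉U = ∈-∪ʳ J (x∈p∧x∉q⇒x∈p─q y∈S y∉U)
        coverG : G ∩ before V K (suc (key x)) ⊆ J∪
        coverG p = let p₁ , p₂ = x∈p∩q⁻ G _ p in ∈-∪ˡ _ (⊆-insert (x∈p∩q⁺ (∈-∪ʳ A p₁ ,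
          ∈-level⁺ w′ (key-antitone-≤ (s≤s⁻¹ (proj₂ (∈-before⁻ V K p₂)))))))

  -- Only `S ∪ D` has to compete: any other element keeps its weight and is spanned by the elements
  -- of `S` that are at least as heavy. Their weights are unchanged as well, and `G` spans them at
  -- that level.
  raise-level-basis : ∀ {w w′ S D G} → LevelBasis w S → (∀ {x} → x ∈ S → x ∉ D) →
    (∀ {x} → x ∈ D → w′ x ≡ suc (w x)) → (∀ {x} → x ∉ D → w′ x ≡ w x) →
    (K : PriorityKey w′) → IsGreedy (S ∪ D) K M ⊥ G → LevelBasis w′ G
  raise-level-basis {w} {w′} {S} {D} {G} lb S∩D=∅ on off K greedy = record
    { level-independent = indep-⊆ M (∈-∪ʳ ⊥) (greedy-independent V K M (indep-∅ M) (λ _ → ∉⊥) greedy)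
    ; positive = λ p → case x∈p∪q⁻ S D (selected-⊆ p) of λ where
        (inj₁ q) → subst (1 ≤_) (sym (off (S∩D=∅ q))) (positive lb q)
        (inj₂ q) → subst (1 ≤_) (sym (on q)) (s≤s z≤n)
    ; spanning = spanning′
    }
    where
    V = S ∪ D
    open PriorityKey K
    open IsGreedy greedy

    dependent : ∀ {x} → x ∈ V → x ∉ G → ¬ Independent M (⁅ x ⁆ ∪ (G ∩ level w′ (w′ x)))
    dependent x∈V x∉G = dependent-⊇ M
      (insert-mono (∪-⊆ (⊥-elim ∘ ∉⊥) λ p → let p₁ , p₂ = x∈p∩q⁻ G _ p in
        x∈p∩q⁺ (p₁ , ∈-level⁺ w′ (key-antitone-≤ (s≤s⁻¹ (proj₂ (∈-before⁻ V K p₂)))))))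
      (greedy-spanned V K M (indep-∅ M) (λ _ → ∉⊥) greedy x∈V x∉G)

    spanning′ : ∀ {x} → x ∉ G → 1 ≤ w′ x → ¬ Independent M (⁅ x ⁆ ∪ (G ∩ level w′ (w′ x)))
    spanning′ {x} x∉G 1≤ with x ∈? V
    ... | yes x∈V = dependent x∈V x∉G
    ... | no x∉V = maximal spanned ∈-insert (x∉G ∘ p∩q⊆p G _)
      where
      U = level w′ (w′ x)
      w′x≡wx = off (x∉V ∘ ∈-∪ʳ S)

      top : IsBasis M (V ∩ U) (G ∩ U)
      top = basis (λ p → let p₁ , p₂ = x∈p∩q⁻ G U p in x∈p∩q⁺ (selected-⊆ p₁ , p₂))
        (indep-⊆ M (∈-∪ʳ ⊥ ∘ p∩q⊆p G U) (greedy-independent V K M (indep-∅ M) (λ _ → ∉⊥) greedy))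
        λ {y} y∈ y∉ → let y∈V , y∈U = x∈p∩q⁻ V U y∈ in
          dependent-⊇ M (insert-mono λ p → let p₁ , p₂ = x∈p∩q⁻ G _ p in
              x∈p∩q⁺ (p₁ , ∈-level⁺ w′ {w′ x} (≤-trans (∈-level⁻ w′ {w′ x} y∈U) (∈-level⁻ w′ p₂))))
            (dependent y∈V λ y∈G → y∉ (x∈p∩q⁺ (y∈G , y∈U)))

      spanned : IsBasis M (⁅ x ⁆ ∪ (V ∩ U)) (G ∩ U)
      spanned = basis-spanned M (indep-⊆ M (p∩q⊆p S _) (level-independent lb))
        (λ p → let p₁ , p₂ = x∈p∩q⁻ S _ p in
          x∈p∩q⁺ (∈-∪ˡ D p₁ , ∈-level⁺ w′ (subst₂′ (∈-level⁻ w p₂) (off (S∩D=∅ p₁)))))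
        (inj₂ (spanning lb (x∉V ∘ ∈-∪ˡ D) (subst (1 ≤_) w′x≡wx 1≤))) top
        where
        subst₂′ : ∀ {y} → w x ≤ w y → w′ y ≡ w y → w′ x ≤ w′ y
        subst₂′ p q = ≤-trans (≤-reflexive w′x≡wx) (≤-trans p (≤-reflexive (sym q)))

-- Shortcut-free paths and simultaneous exchanges

module _ {n} (src snk : Subset n) (succs : Vec (Subset n) n) where

  Edge : Fin n → Fin n → Set
  Edge u v = v ∈ lookup succs u

  -- A path v ∷ q to a sink without forward shortcuts.
  data Induced : Fin n → List (Fin n) → Set where
    end  : ∀ {v} → v ∈ snk → Induced v []
    step : ∀ {v u q} → v ∉ snk → Edge v u → All (λ z → ¬ Edge v z) q → Induced u q → Induced v (u ∷ q)

  -- Cutting at the last suitable vertex removes shortcuts. Applied to the successors of a new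
  -- vertex it yields a shortcut-free extension; applied to the sources it yields a path that meets
  -- them only at its start.
  last-satisfying : ∀ {P : Fin n → Set} (P? : ∀ x → Dec (P x)) {v q} → Induced v q → Any P (v ∷ q) →
                    ∃₂ λ u r → P u × All (¬_ ∘ P) r × Induced u r
  last-satisfying P? p (here Pv) with tail-any p
    where
    tail-any : ∀ {v q} → Induced v q → Any _ q ⊎ All _ q
    tail-any {q = q} _ with Any.any? P? q
    ... | yes a = inj₁ a
    ... | no ¬a = inj₂ (¬Any⇒All¬ q ¬a)
  last-satisfying P? (step _ _ _ p) (here Pv) | inj₁ a = last-satisfying P? p a
  last-satisfying P? p (here Pv) | inj₂ none = _ , _ , Pv , none , p
  last-satisfying P? (step _ _ _ p) (there a) = last-satisfying P? p a

  record AugmentingPath : Set where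
    constructor augmenting
    field
      {first}       : Fin n
      {rest}        : List (Fin n)
      first-source  : first ∈ src
      rest-nosource : All (_∉ src) rest
      path          : Induced first rest

  record Separator : Set where
    field
      region       : Subset n
      region-src   : ∀ {v} → v ∈ region → v ∉ src
      region-snk   : ∀ {v} → v ∉ region → v ∉ snk
      region-edge  : ∀ {u v} → u ∉ region → v ∈ region → ¬ Edge u v

  -- Backward search from the sinks: the set of vertices with a shortcut-free path to a sink gains
  -- one vertex per step, so `n` steps suffice. If it closes up without a source, it is the region
  -- of a separator.
  search : AugmentingPath ⊎ Separator
  search = go n {⊥} (λ p → ⊥-elim (∉⊥ p)) (m≤n+m n _)
    where
    go : ∀ k {R} → (∀ {v} → v ∈ R → ∃ (Induced v)) → n ≤ ∣ R ∣ + k → AugmentingPath ⊎ Separator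
    go k {R} reach n≤ with any? (λ v → ¬? (v ∈? R) ×-dec ((v ∈? snk) ⊎-dec any? (λ u → (u ∈? R) ×-dec (u ∈? lookup succs v))))
    go k {R} reach n≤ | no closed with any? (λ v → (v ∈? R) ×-dec (v ∈? src))
    ... | yes (v , v∈R , v∈src) with last-satisfying (_∈? src) (proj₂ (reach v∈R)) (here v∈src)
    ... | u , r , u∈src , none , p = inj₁ (augmenting u∈src none p)
    go k {R} reach n≤ | no closed | no nosrc = inj₂ record
      { region = R
      ; region-src = λ v∈R v∈src → nosrc (_ , v∈R , v∈src)
      ; region-snk = λ v∉R v∈snk → closed (_ , v∉R , inj₁ v∈snk)
      ; region-edge = λ u∉R v∈R e → closed (_ , u∉R , inj₂ (_ , v∈R , e))
      }
    go zero {R} reach n≤ | yes (v , v∉R , _) =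
      contradiction (subst (_≤ n) (∣insert∣ v∉R) (∣p∣≤n (⁅ v ⁆ ∪ R))) (<⇒≱ (s≤s (subst (n ≤_) (+-identityʳ _) n≤)))
    go (suc k) {R} reach n≤ | yes (v , v∉R , new) = go k {⁅ v ⁆ ∪ R}
        (λ p → case ∈-insert⁻ p of λ { (inj₁ refl) → extended new ; (inj₂ q) → reach q })
        (subst (n ≤_) (trans (+-suc _ k) (cong (_+ k) (sym (∣insert∣ v∉R)))) n≤)
      where
      extended : v ∈ snk ⊎ (∃ λ u → u ∈ R × Edge v u) → ∃ (Induced v)
      extended new with v ∈? snk
      extended new | yes v∈snk = _ , end v∈snk
      extended (inj₁ v∈snk) | no v∉snk = ⊥-elim (v∉snk v∈snk)
      extended (inj₂ (u , u∈R , e)) | no v∉snk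
        with last-satisfying (_∈? lookup succs v) (proj₂ (reach u∈R)) (here e)
      ... | w , r , e′ , none , p = _ , step v∉snk e′ none p

∈-swap⁻ : ∀ {x y z : Fin n} A → z ∈ swap (y , x) A → z ≡ x ⊎ z ∈ A × z ≢ y
∈-swap⁻ {x = x} {y} A p with ∈-insert⁻ {x = x} {A = A - y} p
... | inj₁ q = inj₁ q
... | inj₂ q = inj₂ (∈-remove⁻ A q)

swaps : List (Fin n × Fin n) → Subset n → Subset n
swaps [] I = I
swaps (p ∷ ps) I = swaps ps (swap p I)

∈-swaps⁻ : ∀ ps {I : Subset n} {z} → z ∈ swaps ps I → Any (λ p → z ≡ proj₂ p) ps ⊎ z ∈ I × All (λ p → z ≢ proj₁ p) ps
∈-swaps⁻ [] z∈ = inj₂ (z∈ , [])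
∈-swaps⁻ ((y , x) ∷ ps) {I} z∈ with ∈-swaps⁻ ps z∈
... | inj₁ a = inj₁ (there a)
... | inj₂ (q , ≢ys) with ∈-insert⁻ q
... | inj₁ z≡x = inj₁ (here z≡x)
... | inj₂ r = let z∈I , z≢y = ∈-remove⁻ I r in inj₂ (z∈I , z≢y ∷ ≢ys)

∈-swaps-keep : ∀ ps {I : Subset n} {z} → z ∈ I → All (λ p → z ≢ proj₁ p) ps → z ∈ swaps ps I
∈-swaps-keep [] z∈I [] = z∈I
∈-swaps-keep (p ∷ ps) z∈I (≢y ∷ ≢ys) = ∈-swaps-keep ps (⊆-insert (x∈p∧x≢y⇒x∈p-y z∈I ≢y)) ≢ys

∈-swaps-new : ∀ ps {I : Subset n} {z} → Any (λ p → z ≡ proj₂ p) ps → All (λ p → z ≢ proj₁ p) ps → z ∈ swaps ps I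
∈-swaps-new (p ∷ ps) (here refl) (_ ∷ ≢ys) = ∈-swaps-keep ps ∈-insert ≢ys
∈-swaps-new (p ∷ ps) (there a) (_ ∷ ≢ys) = ∈-swaps-new ps a ≢ys

-- Simultaneous exchanges in one matroid

module _ (M : Matroid n) where

  Exchange : Subset n → Fin n × Fin n → Set
  Exchange I (y , x) = y ∈ I × x ∉ I × Independent M (swap (y , x) I)

  -- Used for a pair and a later pair in the order of execution: what is removed earlier cannot be
  -- traded for what is added later. This triangular pattern is what makes many exchanges
  -- compatible.
  NoShortcut : Subset n → Fin n × Fin n → Fin n × Fin n → Set
  NoShortcut I (y , _) (_ , x) = ¬ Independent M (swap (y , x) I)

  private
    module _ {I : Subset n} {y₁ x₁ : Fin n} (indI : Independent M I) (e₁ : Exchange I (y₁ , x₁)) where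
      I₁ = swap (y₁ , x₁) I

      core : Fin n → Fin n → Subset n
      core y x = ⁅ x ⁆ ∪ (I - y₁ - y)

      core-size : ∀ {y x} → y ∈ I → y ≢ y₁ → x ∉ I → ∣ core y x ∣ < ∣ I ∣
      core-size {y} {x} y∈I y≢y₁ x∉I = ≤-reflexive (begin
        suc ∣ core y x ∣         ≡⟨ cong suc (∣insert∣ (x∉I ∘ p─q⊆p I _ ∘ p─q⊆p (I - y₁) _)) ⟩
        suc (suc ∣ I - y₁ - y ∣) ≡⟨ cong suc (∣remove∣ (x∈p∧x≢y⇒x∈p-y y∈I y≢y₁)) ⟩
        suc ∣ I - y₁ ∣           ≡⟨ ∣remove∣ (proj₁ e₁) ⟩
        ∣ I ∣                    ∎)
        where open ≡-Reasoning

      core-keep : ∀ {y x z} → z ∈ I → z ≢ y₁ → z ≢ y → z ∈ core y x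
      core-keep z∈I z≢y₁ z≢y = ⊆-insert (x∈p∧x≢y⇒x∈p-y (x∈p∧x≢y⇒x∈p-y z∈I z≢y₁) z≢y)

      core-y : ∀ {y x} → swap (y₁ , x) I ⊆ ⁅ y ⁆ ∪ core y x
      core-y {y} {x} {z} p with ∈-swap⁻ {x = x} {y₁} I p | z ≟ᶠ y
      ... | inj₁ refl | _ = ⊆-insert ∈-insert
      ... | inj₂ _ | yes refl = ∈-insert
      ... | inj₂ (z∈I , z≢y₁) | no z≢y = ⊆-insert (core-keep z∈I z≢y₁ z≢y)

      core-y₁ : ∀ {y x} → swap (y , x) I ⊆ ⁅ y₁ ⁆ ∪ core y x
      core-y₁ {y} {x} {z} p with ∈-swap⁻ {x = x} {y} I p | z ≟ᶠ y₁
      ... | inj₁ refl | _ = ⊆-insert ∈-insert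
      ... | inj₂ _ | yes refl = ∈-insert
      ... | inj₂ (z∈I , z≢y) | no z≢y₁ = ⊆-insert (core-keep z∈I z≢y₁ z≢y)

      core-⊆ : ∀ {y x} → core y x ⊆ swap (y , x) I
      core-⊆ {y} = insert-mono λ p → let q , z≢y = ∈-remove⁻ (I - y₁) p in x∈p∧x≢y⇒x∈p-y (p─q⊆p I _ q) z≢y

      core-⊆₁ : ∀ {y x} → core y x ⊆ swap (y , x) I₁
      core-⊆₁ {y} = insert-mono λ p → let q , z≢y = ∈-remove⁻ (I - y₁) p in x∈p∧x≢y⇒x∈p-y (⊆-insert q) z≢y

      -- The set `core y x` has one element less than `I₁` and lacks only `y` and `x₁` from it. The
      -- exchange axiom adds one of them, and adding `y` would give the forbidden exchange of `y₁`
      -- for `x`.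
      exchange-persists : ∀ {y x} → Exchange I (y , x) → NoShortcut I (y₁ , x₁) (y , x) → Exchange I₁ (y , x)
      exchange-persists {y} {x} (y∈I , x∉I , ind) no₁ =
          ⊆-insert (x∈p∧x≢y⇒x∈p-y y∈I y≢y₁)
        , (λ p → case ∈-insert⁻ p of λ { (inj₁ refl) → no₁ (proj₂ (proj₂ e₁)) ; (inj₂ q) → x∉I (p─q⊆p I _ q) })
        , swapped
        where
        y≢y₁ : y ≢ y₁
        y≢y₁ refl = no₁ ind
        swapped : Independent M (swap (y , x) I₁)
        swapped with indep-exch M {core y x} {I₁} (indep-⊆ M core-⊆ ind) (proj₂ (proj₂ e₁))
                       (subst (_ <_) (sym (∣swap∣ (proj₁ (proj₂ e₁)) (proj₁ e₁))) (core-size y∈I y≢y₁ x∉I))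
        ... | z , z∈I₁ , z∉C , ind′ with ∈-insert⁻ z∈I₁
        ... | inj₁ refl = indep-⊆ M (insert-⊆ (⊆-insert ∈-insert) λ p → let q , z≢y = ∈-remove⁻ I₁ p in
                case ∈-insert⁻ q of λ where
                  (inj₁ refl) → ∈-insert
                  (inj₂ r) → let z∈I , z≢y₁ = ∈-remove⁻ I r in ⊆-insert (core-keep z∈I z≢y₁ z≢y)) ind′
        ... | inj₂ q with ∈-remove⁻ I q | z ≟ᶠ y
        ... | _ | yes refl = ⊥-elim (no₁ (indep-⊆ M core-y ind′))
        ... | z∈I , z≢y₁ | no z≢y = ⊥-elim (z∉C (core-keep z∈I z≢y₁ z≢y))

      -- Here `core y x` is enlarged towards `I`, from which it lacks only `y` and `y₁`. Either
      -- choice gives an exchange that was excluded in `I`.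
      noShortcut-persists : ∀ {p q} → Exchange I p → Exchange I q → NoShortcut I (y₁ , x₁) p →
        NoShortcut I (y₁ , x₁) q → NoShortcut I p q → NoShortcut I₁ p q
      noShortcut-persists {y , x₀} {_ , x} (y∈I , _ , ind₀) (_ , x∉I , _) no₀ no₁ no₂ ind
        with indep-exch M {core y x} {I} (indep-⊆ M core-⊆₁ ind) indI (core-size y∈I (λ { refl → no₀ ind₀ }) x∉I)
      ... | z , z∈I , z∉C , ind′ with z ≟ᶠ y | z ≟ᶠ y₁
      ... | yes refl | _ = no₁ (indep-⊆ M core-y ind′)
      ... | no _ | yes refl = no₂ (indep-⊆ M core-y₁ ind′)
      ... | no z≢y | no z≢y₁ = z∉C (core-keep z∈I z≢y₁ z≢y)

  multi-exchange : ∀ ps {I} → Independent M I → All (Exchange I) ps → AllPairs (NoShortcut I) ps →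
                   Independent M (swaps ps I) × ∣ swaps ps I ∣ ≡ ∣ I ∣
  multi-exchange [] indI _ _ = indI , refl
  multi-exchange (p ∷ ps) {I} indI (e ∷ es) (m ∷ ms) =
    let ind , size = multi-exchange ps (proj₂ (proj₂ e)) (persist es m) (persist₂ es m ms)
    in ind , trans size (∣swap∣ (proj₁ (proj₂ e)) (proj₁ e))
    where
    persist : ∀ {qs} → All (Exchange I) qs → All (NoShortcut I p) qs → All (Exchange (swap p I)) qs
    persist [] [] = []
    persist (f ∷ fs) (m ∷ ms) = exchange-persists indI e f m ∷ persist fs ms

    persist₁ : ∀ {q qs} → Exchange I q → NoShortcut I p q → All (Exchange I) qs → All (NoShortcut I p) qs →
               All (NoShortcut I q) qs → All (NoShortcut (swap p I) q) qs
    persist₁ f m [] [] [] = []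
    persist₁ f m (g ∷ gs) (k ∷ ks) (l ∷ ls) = noShortcut-persists indI e f g m k l ∷ persist₁ f m gs ks ls

    persist₂ : ∀ {qs} → All (Exchange I) qs → All (NoShortcut I p) qs → AllPairs (NoShortcut I) qs →
               AllPairs (NoShortcut (swap p I)) qs
    persist₂ [] [] [] = []
    persist₂ (f ∷ fs) (m ∷ ms) (l ∷ ls) = persist₁ f m fs ms l ∷ persist₂ fs ms ls

  module _ {S : Subset n} {x₀ : Fin n} (indS : Independent M S) (x₀∉S : x₀ ∉ S) (ind₀ : Independent M (⁅ x₀ ⁆ ∪ S)) where

    -- Enlarging `swap (y , x) S` towards `⁅ x₀ ⁆ ∪ S` cannot bring back `y`, since `x` is spanned
    -- by `S`; hence it adds `x₀`.
    exchange-augmented : ∀ {p} → ¬ Independent M (⁅ proj₂ p ⁆ ∪ S) → Exchange S p → Exchange (⁅ x₀ ⁆ ∪ S) p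
    exchange-augmented {y , x} dep (y∈S , x∉S , ind) =
      ⊆-insert y∈S ,
      (λ p → case ∈-insert⁻ p of λ { (inj₁ refl) → dep ind₀ ; (inj₂ q) → x∉S q }) ,
      swapped
      where
      swapped : Independent M (swap (y , x) (⁅ x₀ ⁆ ∪ S))
      swapped with indep-exch M {swap (y , x) S} {⁅ x₀ ⁆ ∪ S} ind ind₀
                     (≤-reflexive (trans (cong suc (∣swap∣ x∉S y∈S)) (sym (∣insert∣ x₀∉S))))
      ... | z , z∈ , z∉ , ind′ with ∈-insert⁻ z∈
      ... | inj₁ refl = indep-⊆ M (insert-⊆ (⊆-insert ∈-insert) λ p → let q , z≢y = ∈-remove⁻ (⁅ x₀ ⁆ ∪ S) p in
              case ∈-insert⁻ q of λ where
                (inj₁ refl) → ∈-insert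
                (inj₂ r) → ⊆-insert (⊆-insert (x∈p∧x≢y⇒x∈p-y r z≢y))) ind′
      ... | inj₂ z∈S with z ≟ᶠ y
      ... | no z≢y = ⊥-elim (z∉ (⊆-insert (x∈p∧x≢y⇒x∈p-y z∈S z≢y)))
      ... | yes refl = ⊥-elim (dep (indep-⊆ M (insert-⊆ (⊆-insert ∈-insert) λ {w} w∈S → case w ≟ᶠ z of λ where
              (yes refl) → ∈-insert
              (no w≢z) → ⊆-insert (⊆-insert (x∈p∧x≢y⇒x∈p-y w∈S w≢z))) ind′))

    augment-exchange : ∀ ps → All (λ p → ¬ Independent M (⁅ proj₂ p ⁆ ∪ S)) ps → All (Exchange S) ps →
      AllPairs (NoShortcut S) ps →
      Independent M (swaps ps (⁅ x₀ ⁆ ∪ S)) × ∣ swaps ps (⁅ x₀ ⁆ ∪ S) ∣ ≡ suc ∣ S ∣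
    augment-exchange ps deps es nos =
      let ind , size = multi-exchange ps ind₀ (augmented deps es) (AllPairs.map (λ {p} {q} → superset {p} {q}) nos)
      in ind , trans size (∣insert∣ x₀∉S)
      where
      augmented : ∀ {qs} → All (λ p → ¬ Independent M (⁅ proj₂ p ⁆ ∪ S)) qs → All (Exchange S) qs →
                  All (Exchange (⁅ x₀ ⁆ ∪ S)) qs
      augmented [] [] = []
      augmented (d ∷ ds) (f ∷ fs) = exchange-augmented d f ∷ augmented ds fs
      superset : ∀ {p q} → NoShortcut S p q → NoShortcut (⁅ x₀ ⁆ ∪ S) p q
      superset {y , _} {_ , x} = dependent-⊇ M (insert-mono λ r → let q , z≢y = ∈-remove⁻ S r in
        x∈p∧x≢y⇒x∈p-y (⊆-insert q) z≢y)

-- Augmentation in the exchange graph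

Query : ℕ → Set
Query n = Bool × Subset n

-- The exchange graph of S: edges y → x for M₁ and x → y for M₂, where y ∈ S and x ∉ S.
record ExchangeGraph (n : ℕ) : Set where
  constructor exchangeGraph
  field
    sources sinks : Subset n
    successors    : Vec (Subset n) n

edgeQuery : Subset n → Fin n → Fin n → Query n
edgeQuery S u v = if does (u ∈? S) then (false , swap (u , v) S) else (true , swap (v , u) S)

terminalBit : Subset n → Fin n → Bool → Bool
terminalBit S v answer = if does (v ∈? S) then false else answer

edgeBit : Subset n → Fin n → Fin n → Bool → Bool
edgeBit S u v answer = if does (u ∈? S) xor does (v ∈? S) then answer else false

graphOf : (Query n → Bool) → Subset n → ExchangeGraph n
graphOf O S = exchangeGraph
  (tabulate λ v → terminalBit S v (O (false , ⁅ v ⁆ ∪ S)))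
  (tabulate λ v → terminalBit S v (O (true , ⁅ v ⁆ ∪ S)))
  (tabulate λ u → tabulate λ v → edgeBit S u v (O (edgeQuery S u v)))

OnList : List (Fin n) → Fin n → Set
OnList q z = Any (z ≡_) q

Toggled : Subset n → List (Fin n) → Fin n → Set
Toggled S q z = (z ∈ S × ¬ OnList q z) ⊎ (z ∉ S × OnList q z)

toggled? : ∀ (S : Subset n) q z → Dec (Toggled S q z)
toggled? S q z = ((z ∈? S) ×-dec ¬? (Any.any? (z ≟ᶠ_) q)) ⊎-dec (¬? (z ∈? S) ×-dec Any.any? (z ≟ᶠ_) q)

toggle : Subset n → List (Fin n) → Subset n
toggle S q = ⟨ toggled? S q ⟩

augmentWith : Subset n → ExchangeGraph n → Subset n
augmentWith S (exchangeGraph sources sinks successors) with search sources sinks successors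
... | inj₁ p = toggle S (AugmentingPath.first p ∷ AugmentingPath.rest p)
... | inj₂ _ = S

data Alternating {n} : List (Fin n) → List (Fin n × Fin n) → Set where
  []  : Alternating [] []
  _∷_ : ∀ {q ps} p → Alternating q ps → Alternating (proj₁ p ∷ proj₂ p ∷ q) (p ∷ ps)

alternating-all : ∀ {P : Fin n → Set} {q ps} → Alternating q ps → All P q → All (P ∘ proj₁) ps × All (P ∘ proj₂) ps
alternating-all [] [] = [] , []
alternating-all (p ∷ a) (y ∷ x ∷ r) = let ys , xs = alternating-all a r in y ∷ ys , x ∷ xs

alternating-any : ∀ {P : Fin n → Set} {q ps} → Alternating q ps → Any P q → Any (P ∘ proj₁) ps ⊎ Any (P ∘ proj₂) ps
alternating-any (p ∷ a) (here y) = inj₁ (here y)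
alternating-any (p ∷ a) (there (here x)) = inj₂ (here x)
alternating-any (p ∷ a) (there (there r)) with alternating-any a r
... | inj₁ s = inj₁ (there s)
... | inj₂ s = inj₂ (there s)

tabulate-∈⁺ : ∀ {f : Fin n → Bool} {x} → f x ≡ true → x ∈ tabulate f
tabulate-∈⁺ {f = f} {x} eq = lookup⇒[]= x _ (trans (lookup∘tabulate f x) eq)

tabulate-∈⁻ : ∀ {f : Fin n → Bool} {x} → x ∈ tabulate f → f x ≡ true
tabulate-∈⁻ {f = f} {x} p = trans (sym (lookup∘tabulate f x)) ([]=⇒lookup p)

module _ {n} (M₁ M₂ : Matroid n) where

  Common : Subset n → Set
  Common S = Independent M₁ S × Independent M₂ S

  module _ (S : Subset n) where

    private
      O = ask M₁ M₂
      open ExchangeGraph (graphOf O S)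

      E : Fin n → Fin n → Set
      E = Edge sources sinks successors

      Path : Fin n → List (Fin n) → Set
      Path = Induced sources sinks successors

    terminal⁺ : ∀ {b v} → v ∉ S → O (b , ⁅ v ⁆ ∪ S) ≡ true → v ∈ tabulate (λ v → terminalBit S v (O (b , ⁅ v ⁆ ∪ S)))
    terminal⁺ {b} {v} v∉S ind = tabulate-∈⁺ (helper v∉S)
      where
      helper : v ∉ S → terminalBit S v (O (b , ⁅ v ⁆ ∪ S)) ≡ true
      helper v∉S with v ∈? S
      ... | yes v∈S = ⊥-elim (v∉S v∈S)
      ... | no _ = ind

    terminal⁻ : ∀ {b v} → v ∈ tabulate (λ v → terminalBit S v (O (b , ⁅ v ⁆ ∪ S))) → v ∉ S × O (b , ⁅ v ⁆ ∪ S) ≡ true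
    terminal⁻ {b} {v} p with tabulate-∈⁻ {f = λ v → terminalBit S v (O (b , ⁅ v ⁆ ∪ S))} p
    ... | eq with v ∈? S
    ... | yes v∈S = case eq of λ ()
    ... | no v∉S = v∉S , eq

    edge-bit : ∀ {u v} → E u v → edgeBit S u v (O (edgeQuery S u v)) ≡ true
    edge-bit {u} {v} e = tabulate-∈⁻ (subst (v ∈_) (lookup∘tabulate _ u) e)

    bit-edge : ∀ {u v} → edgeBit S u v (O (edgeQuery S u v)) ≡ true → E u v
    bit-edge {u} {v} eq = subst (v ∈_) (sym (lookup∘tabulate _ u)) (tabulate-∈⁺ eq)

    edge₁⁻ : ∀ {u v} → u ∈ S → E u v → Exchange M₁ S (u , v)
    edge₁⁻ {u} {v} u∈S e with edge-bit e
    ... | eq with u ∈? S | v ∈? S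
    ... | yes _ | yes _ = case eq of λ ()
    ... | yes _ | no v∉S = u∈S , v∉S , eq
    ... | no u∉S | _ = ⊥-elim (u∉S u∈S)

    edge₂⁻ : ∀ {u v} → u ∉ S → E u v → Exchange M₂ S (v , u)
    edge₂⁻ {u} {v} u∉S e with edge-bit e
    ... | eq with u ∈? S | v ∈? S
    ... | yes u∈S | _ = ⊥-elim (u∉S u∈S)
    ... | no _ | yes v∈S = v∈S , u∉S , eq
    ... | no _ | no _ = case eq of λ ()

    edge₁⁺ : ∀ {u v} → Exchange M₁ S (u , v) → E u v
    edge₁⁺ {u} {v} (u∈S , v∉S , ind) = bit-edge helper
      where
      helper : edgeBit S u v (O (edgeQuery S u v)) ≡ true
      helper with u ∈? S | v ∈? S
      ... | yes _ | no _ = ind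
      ... | yes _ | yes v∈S = ⊥-elim (v∉S v∈S)
      ... | no u∉S | _ = ⊥-elim (u∉S u∈S)

    edge₂⁺ : ∀ {u v} → Exchange M₂ S (v , u) → E u v
    edge₂⁺ {u} {v} (v∈S , u∉S , ind) = bit-edge helper
      where
      helper : edgeBit S u v (O (edgeQuery S u v)) ≡ true
      helper with u ∈? S | v ∈? S
      ... | no _ | yes _ = ind
      ... | no _ | no v∉S = ⊥-elim (v∉S v∈S)
      ... | yes u∈S | _ = ⊥-elim (u∉S u∈S)

    -- For M₁ the pairs follow the path order, since a missing forward edge out of `y` says that `y`
    -- cannot be traded for a later `x`.
    path-exchanges₁ : ∀ {v q} → v ∉ S → Path v q → ∃ λ ps →
      Alternating q ps × All (Exchange M₁ S) ps × AllPairs (NoShortcut M₁ S) ps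
    path-exchanges₁ v∉S (end _) = [] , [] , [] , []
    path-exchanges₁ v∉S (step _ e _ (end y∈snk)) =
      ⊥-elim (proj₁ (terminal⁻ y∈snk) (proj₁ (edge₂⁻ v∉S e)))
    path-exchanges₁ v∉S (step {u = y} _ e _ (step {u = x} _ e′ none p))
      with edge₁⁻ (proj₁ (edge₂⁻ v∉S e)) e′
    ... | ex with path-exchanges₁ (proj₁ (proj₂ ex)) p
    ... | ps , alt , exs , nos = (y , x) ∷ ps , (y , x) ∷ alt , ex ∷ exs , no-edge (proj₂ (alternating-all alt none)) exs ∷ nos
      where
      no-edge : ∀ {ps} → All (λ p → ¬ E y (proj₂ p)) ps → All (Exchange M₁ S) ps → All (NoShortcut M₁ S (y , x)) ps
      no-edge [] [] = []
      no-edge (ne ∷ nes) (f ∷ fs) = (λ ind → ne (edge₁⁺ (proj₁ ex , proj₁ (proj₂ f) , ind))) ∷ no-edge nes fs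

    -- Along the path the exchanges for M₂ are triangular in the reverse order, so they are accumulated.
    path-exchanges₂ : ∀ {P : Fin n → Set} {v q acc} → v ∉ S → Path v q → All P q →
      All (P ∘ proj₁) acc → All (Exchange M₂ S) acc → AllPairs (NoShortcut M₂ S) acc →
      All (λ p → proj₂ p ∉ sinks) acc → All (λ p → All (λ z → ¬ E (proj₂ p) z) q) acc →
      ∃₂ λ x ps → x ∈ sinks × All (P ∘ proj₁) ps × All (Exchange M₂ S) ps × AllPairs (NoShortcut M₂ S) ps ×
        All (λ p → proj₂ p ∉ sinks) ps ×
        (∀ {z} → z ∉ S → OnList (v ∷ q) z ⊎ Any (λ p → z ≡ proj₂ p) acc → z ≡ x ⊎ Any (λ p → z ≡ proj₂ p) ps)
    path-exchanges₂ {acc = acc} v∉S (end v∈snk) _ Pys exs nos nosnk _ =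
      _ , acc , v∈snk , Pys , exs , nos , nosnk , λ where
        _ (inj₁ (here z≡v)) → inj₁ z≡v
        _ (inj₂ a) → inj₂ a
    path-exchanges₂ v∉S (step _ e _ (end y∈snk)) _ _ _ _ _ _ =
      ⊥-elim (proj₁ (terminal⁻ y∈snk) (proj₁ (edge₂⁻ v∉S e)))
    path-exchanges₂ {v = v} {acc = acc} v∉S (step {u = y} v∉snk e (_ ∷ none) (step {u = x} _ e′ _ p)) (Py ∷ Px ∷ Pq) Pys exs nos nosnk noedge
      with path-exchanges₂ {acc = (y , v) ∷ acc} (proj₁ (proj₂ (edge₁⁻ (proj₁ (edge₂⁻ v∉S e)) e′))) p Pq
             (Py ∷ Pys) (edge₂⁻ v∉S e ∷ exs) (no-edge noedge exs ∷ nos) (v∉snk ∷ nosnk)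
             (none ∷ All.map (λ { (_ ∷ _ ∷ r) → r }) noedge)
      where
      no-edge : ∀ {acc} → All (λ p → All (λ z → ¬ E (proj₂ p) z) (y ∷ x ∷ _)) acc → All (Exchange M₂ S) acc →
                All (NoShortcut M₂ S (y , v)) acc
      no-edge [] [] = []
      no-edge ((ne ∷ _) ∷ nes) (f ∷ fs) =
        (λ ind → ne (edge₂⁺ (proj₁ (edge₂⁻ v∉S e) , proj₁ (proj₂ f) , ind))) ∷ no-edge nes fs
    ... | xₖ , ps , snk , Pys′ , exs′ , nos′ , nosnk′ , cover = xₖ , ps , snk , Pys′ , exs′ , nos′ , nosnk′ , λ where
      z∉S (inj₁ (here z≡v)) → cover z∉S (inj₂ (here z≡v))
      z∉S (inj₁ (there (here refl))) → ⊥-elim (z∉S (proj₁ (edge₂⁻ v∉S e)))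
      z∉S (inj₁ (there (there a))) → cover z∉S (inj₁ a)
      z∉S (inj₂ a) → cover z∉S (inj₂ (there a))

    module _ (common : Common S) where

      -- In M₁ the first vertex is the additional element and in M₂ the last one; the remaining
      -- vertices are paired differently in the two matroids. For M₁ equality with the swapped set
      -- is shown, which also yields the size, while for M₂ inclusion suffices.
      toggle-common : (p : AugmentingPath sources sinks successors) →
        let T = toggle S (AugmentingPath.first p ∷ AugmentingPath.rest p) in Common T × ∣ T ∣ ≡ suc ∣ S ∣
      toggle-common (augmenting {v} {q} v∈src nosrc path)
        with path-exchanges₁ (proj₁ (terminal⁻ v∈src)) path
           | path-exchanges₂ {P = OnList (v ∷ q)} (proj₁ (terminal⁻ v∈src)) path on-self [] [] [] [] []
        where
        on-self : All (OnList (v ∷ q)) q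
        on-self = All.map there (All.tabulate id)
      ... | ps , alt , exs , nos | x , ps₂ , x∈snk , on , exs₂ , nos₂ , nosnk , cover =
        (subst (Independent M₁) swaps≡T (proj₁ aug₁) , indep-⊆ M₂ T⊆₂ (proj₁ aug₂)) ,
        trans (cong ∣_∣ (sym swaps≡T)) (proj₂ aug₁)
        where
        T = toggle S (v ∷ q)
        v∉S = proj₁ (terminal⁻ v∈src)

        aug₁ = augment-exchange M₁ (proj₁ common) v∉S (proj₂ (terminal⁻ v∈src)) ps
          (deps (proj₂ (alternating-all alt nosrc)) exs) exs nos
          where
          deps : ∀ {ps} → All (λ p → proj₂ p ∉ sources) ps → All (Exchange M₁ S) ps →
                 All (λ p → ¬ Independent M₁ (⁅ proj₂ p ⁆ ∪ S)) ps
          deps [] [] = []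
          deps (s ∷ ss) (e ∷ es) = (λ ind → s (terminal⁺ (proj₁ (proj₂ e)) ind)) ∷ deps ss es

        aug₂ = augment-exchange M₂ (proj₂ common) (proj₁ (terminal⁻ x∈snk)) (proj₂ (terminal⁻ x∈snk)) ps₂
          (deps nosnk exs₂) exs₂ nos₂
          where
          deps : ∀ {ps} → All (λ p → proj₂ p ∉ sinks) ps → All (Exchange M₂ S) ps →
                 All (λ p → ¬ Independent M₂ (⁅ proj₂ p ⁆ ∪ S)) ps
          deps [] [] = []
          deps (s ∷ ss) (e ∷ es) = (λ ind → s (terminal⁺ (proj₁ (proj₂ e)) ind)) ∷ deps ss es

        on₁ : All (OnList q ∘ proj₁) ps × All (OnList q ∘ proj₂) ps
        on₁ = alternating-all alt (All.tabulate id)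

        apart : ∀ {P : Fin n → Set} {z} {ps : List (Fin n × Fin n)} → ¬ P z → All (P ∘ proj₁) ps → All (λ p → z ≢ proj₁ p) ps
        apart ¬Pz = All.map λ { Py refl → ¬Pz Py }

        S-apart : ∀ M {z ps} → z ∉ S → All (Exchange M S) ps → All (λ p → z ≢ proj₁ p) ps
        S-apart _ z∉S = All.map λ { e refl → z∉S (proj₁ e) }

        T⊆₂ : T ⊆ swaps ps₂ (⁅ x ⁆ ∪ S)
        T⊆₂ z∈T with ∈⟨⟩⁻ (toggled? S (v ∷ q)) z∈T
        ... | inj₁ (z∈S , z∉P) = ∈-swaps-keep ps₂ (⊆-insert z∈S) (apart {P = OnList (v ∷ q)} z∉P on)
        ... | inj₂ (z∉S , z∈P) with cover z∉S (inj₁ z∈P)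
        ... | inj₁ refl = ∈-swaps-keep ps₂ ∈-insert (S-apart M₂ z∉S exs₂)
        ... | inj₂ a = ∈-swaps-new ps₂ a (S-apart M₂ z∉S exs₂)

        T⊆₁ : T ⊆ swaps ps (⁅ v ⁆ ∪ S)
        T⊆₁ z∈T with ∈⟨⟩⁻ (toggled? S (v ∷ q)) z∈T
        ... | inj₁ (z∈S , z∉P) = ∈-swaps-keep ps (⊆-insert z∈S) (apart {P = OnList q} (z∉P ∘ there) (proj₁ on₁))
        ... | inj₂ (z∉S , here refl) = ∈-swaps-keep ps ∈-insert (S-apart M₁ z∉S exs)
        ... | inj₂ (z∉S , there z∈q) with alternating-any {P = _ ≡_} alt z∈q
        ... | inj₁ a = ⊥-elim (All¬⇒¬Any (S-apart M₁ z∉S exs) a)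
        ... | inj₂ a = ∈-swaps-new ps a (S-apart M₁ z∉S exs)

        swaps⊆T : swaps ps (⁅ v ⁆ ∪ S) ⊆ T
        swaps⊆T z∈ = ∈⟨⟩⁺ (toggled? S (v ∷ q)) (classify (∈-swaps⁻ ps z∈))
          where
          new : ∀ {z ps} → Any (λ p → z ≡ proj₂ p) ps → All (OnList q ∘ proj₂) ps → All (Exchange M₁ S) ps →
                z ∉ S × OnList q z
          new (here refl) (o ∷ _) (e ∷ _) = proj₁ (proj₂ e) , o
          new (there a) (_ ∷ os) (_ ∷ es) = new a os es
          classify : ∀ {z} → Any (λ p → z ≡ proj₂ p) ps ⊎ z ∈ ⁅ v ⁆ ∪ S × All (λ p → z ≢ proj₁ p) ps → Toggled S (v ∷ q) z
          classify (inj₁ a) = let z∉S , z∈q = new a (proj₂ on₁) exs in inj₂ (z∉S , there z∈q)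
          classify (inj₂ (z∈ , ≢ys)) with ∈-insert⁻ z∈
          ... | inj₁ refl = inj₂ (v∉S , here refl)
          ... | inj₂ z∈S = inj₁ (z∈S , λ where
            (here refl) → v∉S z∈S
            (there z∈q) → case alternating-any {P = _ ≡_} alt z∈q of λ where
              (inj₁ a) → All¬⇒¬Any ≢ys a
              (inj₂ a) → proj₁ (new a (proj₂ on₁) exs) z∈S)

        swaps≡T : swaps ps (⁅ v ⁆ ∪ S) ≡ T
        swaps≡T = ⊆-antisym swaps⊆T T⊆₁

      -- Any common independent set is bounded by the rank of `R` in M₁ plus the rank of its
      -- complement in M₂. `S` attains this bound: without sources in `R`, sinks outside it or edges
      -- entering it, the fundamental circuits stay on their side of the separation.
      separator-maximum : Separator sources sinks successors → ∀ T → Common T → ∣ T ∣ ≤ ∣ S ∣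
      separator-maximum sep T (T₁ , T₂) = begin
        ∣ T ∣                 ≡⟨ ∣split∣ T R ⟩
        ∣ T ∩ R ∣ + ∣ T ─ R ∣ ≤⟨ +-mono-≤ (basis-largest M₁ β₁ (indep-⊆ M₁ (p∩q⊆p T R) T₁) (p∩q⊆q T R))
                                         (basis-largest M₂ β₂ (indep-⊆ M₂ (p─q⊆p T R) T₂) (x∉p⇒x∈∁p ∘ proj₂ ∘ ∈-─⁻ T R)) ⟩
        ∣ S ∩ R ∣ + ∣ S ─ R ∣ ≡⟨ ∣split∣ S R ⟨
        ∣ S ∣                 ∎
        where
        open ≤-Reasoning
        open Separator sep renaming (region to R)
        β₁ : IsBasis M₁ R (S ∩ R)
        β₁ = basis (p∩q⊆q S R) (indep-⊆ M₁ (p∩q⊆p S R) (proj₁ common)) λ {x} x∈R x∉ →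
          let x∉S = λ x∈S → x∉ (x∈p∩q⁺ (x∈S , x∈R)) in
          spanned-by M₁ (proj₁ common) x∉S (p∩q⊆p S R) (λ ind → region-src x∈R (terminal⁺ x∉S ind))
            λ y∈S y∉ ind → region-edge (λ y∈R → y∉ (x∈p∩q⁺ (y∈S , y∈R))) x∈R (edge₁⁺ (y∈S , x∉S , ind))
        β₂ : IsBasis M₂ (∁ R) (S ─ R)
        β₂ = basis (x∉p⇒x∈∁p ∘ proj₂ ∘ ∈-─⁻ S R) (indep-⊆ M₂ (p─q⊆p S R) (proj₂ common)) λ {x} x∈∁R x∉ →
          let x∉R = x∈∁p⇒x∉p x∈∁R
              x∉S = λ x∈S → x∉ (x∈p∧x∉q⇒x∈p─q x∈S x∉R) in
          spanned-by M₂ (proj₂ common) x∉S (p─q⊆p S R) (λ ind → region-snk x∉R (terminal⁺ x∉S ind))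
            λ {y} y∈S y∉ ind → case y ∈? R of λ where
              (yes y∈R) → region-edge x∉R y∈R (edge₂⁺ (y∈S , x∉S , ind))
              (no y∉R) → y∉ (x∈p∧x∉q⇒x∈p─q y∈S y∉R)

      augment-correct : let S′ = augmentWith S (graphOf O S) in
        Common S′ × (∣ S′ ∣ ≡ suc ∣ S ∣ ⊎ ∣ S ∣ ≤ ∣ S′ ∣ × (∀ T → Common T → ∣ T ∣ ≤ ∣ S ∣))
      augment-correct with search sources sinks successors
      ... | inj₁ p = let common′ , size = toggle-common p in common′ , inj₁ size
      ... | inj₂ sep = common , inj₂ (≤-refl , separator-maximum sep)

-- Query protocols

module _ where

  private variable
    Q Q′ R R′ m : ℕ
    A B : Set

  -- The number of rounds is an index and thus fixed whatever the answers are. Computations that end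
  -- early are prolonged by `idle` or by steps that keep what has been achieved.
  data Protocol (n Q : ℕ) (A : Set) : ℕ → Set where
    done  : A → Protocol n Q A zero
    round : (qs : List (Query n)) → length qs ≤ Q → (List Bool → Protocol n Q A R) → Protocol n Q A (suc R)

  Oracle : ℕ → Set
  Oracle n = Query n → Bool

  eval : Oracle n → Protocol n Q A R → A
  eval O (done a) = a
  eval O (round qs _ k) = eval O (k (map O qs))

  mapᴾ : (A → B) → Protocol n Q A R → Protocol n Q B R
  mapᴾ f (done a) = done (f a)
  mapᴾ f (round qs le k) = round qs le λ as → mapᴾ f (k as)

  eval-map : ∀ (O : Oracle n) (f : A → B) (p : Protocol n Q A R) → eval O (mapᴾ f p) ≡ f (eval O p)
  eval-map O f (done a) = refl
  eval-map O f (round qs _ k) = eval-map O f (k (map O qs))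

  bind : Protocol n Q A R → (A → Protocol n Q B R′) → Protocol n Q B (R + R′)
  bind (done a) f = f a
  bind (round qs le k) f = round qs le λ as → bind (k as) f

  eval-bind : ∀ (O : Oracle n) (p : Protocol n Q A R) (f : A → Protocol n Q B R′) →
              eval O (bind p f) ≡ eval O (f (eval O p))
  eval-bind O (done a) f = refl
  eval-bind O (round qs _ k) f = eval-bind O (k (map O qs)) f

  weaken : Q ≤ Q′ → Protocol n Q A R → Protocol n Q′ A R
  weaken le (done a) = done a
  weaken le (round qs le′ k) = round qs (≤-trans le′ le) λ as → weaken le (k as)

  eval-weaken : ∀ (O : Oracle n) (le : Q ≤ Q′) (p : Protocol n Q A R) → eval O (weaken le p) ≡ eval O p
  eval-weaken O le (done a) = refl
  eval-weaken O le (round qs _ k) = eval-weaken O le (k (map O qs))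

  idle : ∀ R → A → Protocol n Q A R
  idle zero a = done a
  idle (suc R) a = round [] z≤n λ _ → idle R a

  eval-idle : ∀ (O : Oracle n) R (a : A) → eval O (idle {Q = Q} R a) ≡ a
  eval-idle O zero a = refl
  eval-idle O (suc R) a = eval-idle O R a

  iterate : ∀ N → (A → Protocol n Q A R) → A → Protocol n Q A (N * R)
  iterate zero f a = done a
  iterate (suc N) f a = bind (f a) (iterate N f)

  eval-iterate : ∀ (O : Oracle n) N (f : A → Protocol n Q A R) a →
                 eval O (iterate (suc N) f a) ≡ eval O (iterate N f (eval O (f a)))
  eval-iterate O N f a = eval-bind O (f a) (iterate N f)

  both : Protocol n Q A R → Protocol n Q′ B R → Protocol n (Q + Q′) (A × B) R
  both (done a) (done b) = done (a , b)
  both (round qs le k) (round qs′ le′ k′) =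
    round (qs ++ qs′) (≤-trans (≤-reflexive (length-++ qs)) (+-mono-≤ le le′))
      λ as → both (k (take (length qs) as)) (k′ (drop (length qs) as))

  take-map-++ : ∀ (f : A → B) xs ys → take (length xs) (map f xs ++ ys) ≡ map f xs
  take-map-++ f [] ys = refl
  take-map-++ f (x ∷ xs) ys = cong (f x ∷_) (take-map-++ f xs ys)

  drop-map-++ : ∀ (f : A → B) xs ys → drop (length xs) (map f xs ++ ys) ≡ ys
  drop-map-++ f [] ys = refl
  drop-map-++ f (x ∷ xs) ys = drop-map-++ f xs ys

  eval-both : ∀ (O : Oracle n) (p : Protocol n Q A R) (q : Protocol n Q′ B R) →
              eval O (both p q) ≡ (eval O p , eval O q)
  eval-both O (done a) (done b) = refl
  eval-both O (round qs _ k) (round qs′ _ k′)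
    rewrite map-++ O qs qs′ | take-map-++ O qs (map O qs′) | drop-map-++ O qs (map O qs′) =
    eval-both O (k (map O qs)) (k′ (map O qs′))

  parallel : (Fin m → Protocol n Q A R) → Protocol n (m * Q) (Vec A m) R
  parallel {m = zero} {R = R} f = idle R []
  parallel {m = suc m} f = mapᴾ (λ (a , as) → a ∷ as) (both (f zero) (parallel (f ∘ suc)))

  eval-parallel : ∀ (O : Oracle n) (f : Fin m → Protocol n Q A R) → eval O (parallel f) ≡ tabulate (eval O ∘ f)
  eval-parallel {m = zero} {R = R} O f = eval-idle O R []
  eval-parallel {m = suc m} O f = begin
    eval O (mapᴾ _ (both (f zero) (parallel (f ∘ suc)))) ≡⟨ eval-map O _ (both (f zero) _) ⟩
    (let a , as = eval O (both (f zero) (parallel (f ∘ suc))) in a ∷ as) ≡⟨ cong (λ (a , as) → a ∷ as) (eval-both O (f zero) _) ⟩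
    eval O (f zero) ∷ eval O (parallel (f ∘ suc)) ≡⟨ cong (eval O (f zero) ∷_) (eval-parallel O (f ∘ suc)) ⟩
    tabulate (eval O ∘ f) ∎
    where open ≡-Reasoning

  query : Query n → Protocol n 1 Bool 1
  query q = round (q ∷ []) ≤-refl λ where
    (b ∷ _) → done b
    [] → done false

  _≟Q_ : (p q : Query n) → Dec (p ≡ q)
  _≟Q_ = ×-≡-dec _≟ᵇ_ (Vecₚ.≡-dec _≟ᵇ_)

  answer : List (Query n) → List Bool → Query n → Bool
  answer (q ∷ qs) (b ∷ bs) p = if does (p ≟Q q) then b else answer qs bs p
  answer _ _ p = false

  answer-correct : ∀ (O : Oracle n) qs {p} → p ∈ᴸ qs → answer qs (map O qs) p ≡ O p
  answer-correct O (q ∷ qs) {p} p∈ with p ≟Q q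
  answer-correct O (q ∷ qs) p∈ | yes refl = refl
  answer-correct O (q ∷ qs) (here eq) | no p≢q = ⊥-elim (p≢q eq)
  answer-correct O (q ∷ qs) (there p∈) | no _ = answer-correct O qs p∈

  -- `F` is written as if it had the whole oracle, but it is run on a substitute that knows only the
  -- answers to `qs`. The result is right whenever `F` consults nothing else.
  oneRound : (qs : List (Query n)) → (Oracle n → A) → Protocol n (length qs) A 1
  oneRound qs F = round qs ≤-refl λ as → done (F (answer qs as))

  eval-oneRound : ∀ (O : Oracle n) qs (F : Oracle n → A) →
    (∀ O′ → (∀ {p} → p ∈ᴸ qs → O′ p ≡ O p) → F O′ ≡ F O) → eval O (oneRound qs F) ≡ F O
  eval-oneRound O qs F agree = agree _ (answer-correct O qs)

  -- A round of `RoundAlg` has exactly `Q` queries; the free places ask about `⊥` in M₁, and their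
  -- answers are dropped again by `take`.
  pad : ∀ Q → List (Query n) → Vec (Query n) Q
  pad Q [] = Vec.replicate Q (false , ⊥)
  pad zero (q ∷ qs) = []
  pad (suc Q) (q ∷ qs) = q ∷ pad Q qs

  unpad : ∀ (O : Oracle n) qs → length qs ≤ Q → take (length qs) (Vec.toList (Vec.map O (pad Q qs))) ≡ map O qs
  unpad O [] _ = refl
  unpad O (q ∷ qs) (s≤s le) = cong (O q ∷_) (unpad O qs le)

  nextQueries : Protocol n Q A R → List (Vec Bool Q) → Vec (Query n) Q
  nextQueries (done _) _ = Vec.replicate _ (false , ⊥)
  nextQueries (round qs _ k) [] = pad _ qs
  nextQueries (round qs _ k) (a ∷ as) = nextQueries (k (take (length qs) (Vec.toList a))) as

  finalOutput : Protocol n Q (Subset n) R → List (Vec Bool Q) → Subset n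
  finalOutput (done S) _ = S
  finalOutput (round qs _ k) [] = ⊥
  finalOutput (round qs _ k) (a ∷ as) = finalOutput (k (take (length qs) (Vec.toList a))) as

  algorithm : Protocol n Q (Subset n) R → RoundAlg n Q 0
  algorithm p = record { queries = λ _ → nextQueries p ; output = λ _ → finalOutput p }

  module _ (M₁ M₂ : Matroid n) where

    private
      O = ask M₁ M₂

      -- A history with an arbitrary beginning, so that the first round can be split off.
      resume : (List (Vec Bool Q) → Vec (Query n) Q) → ℕ → List (Vec Bool Q) → List (Vec Bool Q)
      resume f zero h = h
      resume f (suc j) h = resume f j h ∷ʳ Vec.map O (f (resume f j h))

      resume-suc : ∀ (f : List (Vec Bool Q) → Vec (Query n) Q) j h →
                   resume f (suc j) h ≡ resume f j (h ∷ʳ Vec.map O (f h))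
      resume-suc f zero h = refl
      resume-suc f (suc j) h = cong (λ h → h ∷ʳ Vec.map O (f h)) (resume-suc f j h)

      resume-∷ : ∀ (f : List (Vec Bool Q) → Vec (Query n) Q) a j h → resume f j (a ∷ h) ≡ a ∷ resume (f ∘ (a ∷_)) j h
      resume-∷ f a zero h = refl
      resume-∷ f a (suc j) h = cong (λ h → h ∷ʳ Vec.map O (f h)) (resume-∷ f a j h)

      resume-history : ∀ (p : Protocol n Q (Subset n) R) r j →
                       history (algorithm p) M₁ M₂ r j ≡ resume (nextQueries p) j []
      resume-history p r zero = refl
      resume-history p r (suc j) = cong (λ h → h ∷ʳ Vec.map O (nextQueries p h)) (resume-history p r j)

      resume-output : ∀ (p : Protocol n Q (Subset n) R) → finalOutput p (resume (nextQueries p) R []) ≡ eval O p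
      resume-output (done S) = refl
      resume-output {Q = Q} {R = suc R} p@(round qs le k)
        rewrite resume-suc (nextQueries p) R [] | resume-∷ (nextQueries p) (Vec.map O (pad Q qs)) R []
              | unpad O qs le = resume-output (k (map O qs))

    run-algorithm : ∀ (p : Protocol n Q (Subset n) R) r → run (algorithm p) M₁ M₂ r R ≡ eval O p
    run-algorithm {R = R} p r = trans (cong (finalOutput p) (resume-history p r R)) (resume-output p)

-- Completing an independent set to a basis

insertAll : Subset n → List (Fin n) → Subset n
insertAll X [] = X
insertAll X (x ∷ xs) = insertAll (⁅ x ⁆ ∪ X) xs

⊆-insertAll : ∀ xs {X : Subset n} → X ⊆ insertAll X xs
⊆-insertAll [] = id
⊆-insertAll (x ∷ xs) = ⊆-insertAll xs ∘ ⊆-insert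

∈-insertAll⁺ : ∀ {xs} {X : Subset n} {z} → z ∈ᴸ xs → z ∈ insertAll X xs
∈-insertAll⁺ {xs = x ∷ xs} (here refl) = ⊆-insertAll xs ∈-insert
∈-insertAll⁺ (there z∈) = ∈-insertAll⁺ z∈

∈-insertAll⁻ : ∀ xs {X : Subset n} {z} → z ∈ insertAll X xs → z ∈ X ⊎ z ∈ᴸ xs
∈-insertAll⁻ [] z∈ = inj₁ z∈
∈-insertAll⁻ (x ∷ xs) z∈ with ∈-insertAll⁻ xs z∈
... | inj₂ r = inj₂ (there r)
... | inj₁ r with ∈-insert⁻ r
... | inj₁ eq = inj₂ (here eq)
... | inj₂ q = inj₁ q

insertAll-mono : ∀ xs {X Y : Subset n} → X ⊆ Y → insertAll X xs ⊆ insertAll Y xs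
insertAll-mono xs X⊆Y z∈ with ∈-insertAll⁻ xs z∈
... | inj₁ z∈X = ⊆-insertAll xs (X⊆Y z∈X)
... | inj₂ z∈xs = ∈-insertAll⁺ z∈xs

insertAll-insert : ∀ xs x (X : Subset n) → insertAll (⁅ x ⁆ ∪ X) xs ≡ ⁅ x ⁆ ∪ insertAll X xs
insertAll-insert xs x X = ⊆-antisym
  (λ z∈ → case ∈-insertAll⁻ xs z∈ of λ where
    (inj₁ p) → insert-mono (⊆-insertAll xs) p
    (inj₂ p) → ⊆-insert (∈-insertAll⁺ p))
  (insert-⊆ (⊆-insertAll xs ∈-insert) (insertAll-mono xs ⊆-insert))

elements : Subset n → List (Fin n)
elements C = filter (_∈? C) (allFin _)

insertAll-elements : ∀ (I C : Subset n) → insertAll I (elements C) ≡ I ∪ C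
insertAll-elements I C = ⊆-antisym
  (λ z∈ → case ∈-insertAll⁻ (elements C) z∈ of λ where
    (inj₁ p) → ∈-∪ˡ C p
    (inj₂ p) → ∈-∪ʳ I (proj₂ (∈-filter⁻ (_∈? C) {xs = allFin _} p)))
  (∪-⊆ (⊆-insertAll (elements C)) (λ p → ∈-insertAll⁺ (∈-filter⁺ (_∈? C) (∈-allFin _) p)))

length-elements : ∀ (C : Subset n) → length (elements C) ≤ n
length-elements {n} C = ≤-trans (length-filter (_∈? C) (allFin n)) (≤-reflexive (length-tabulate id))

data Scan (n : ℕ) : Set where
  grow   : Subset n → Scan n
  shrink : List (Fin n) → Scan n

keep : Fin n → Scan n → Scan n
keep x (grow J) = grow J
keep x (shrink xs) = shrink (x ∷ xs)

fresh : (Subset n → Bool) → Subset n → Fin n → Bool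
fresh o run x = not (does (x ∈? run)) ∧ o (⁅ x ⁆ ∪ run)

-- Reads the candidates from left to right, adding them to I while they are
-- independent.  A run of s additions replaces I; an element that is spanned by
-- the current run is deleted and the next run restarts from I.
scan : (Subset n → Bool) → ℕ → Subset n → ℕ → Subset n → List (Fin n) → Scan n
scan o s I c run [] = shrink []
scan o s I c run (x ∷ xs) with fresh o run x | suc c <? s
... | false | _     = scan o s I 0 I xs
... | true  | yes _ = keep x (scan o s I (suc c) (⁅ x ⁆ ∪ run) xs)
... | true  | no _  = grow (⁅ x ⁆ ∪ run)

runs : Subset n → List (Fin n) → List (Subset n)
runs run [] = []
runs run (x ∷ xs) = (⁅ x ⁆ ∪ run) ∷ runs (⁅ x ⁆ ∪ run) xs

-- A run starts from `I` at any candidate and takes consecutive ones, so quadratically many sets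
-- cover all that a scan may ask for, whatever the answers turn out to be.
allRuns : Subset n → List (Fin n) → List (Subset n)
allRuns I [] = []
allRuns I (x ∷ xs) = runs I (x ∷ xs) ++ allRuns I xs

length-runs : ∀ (run : Subset n) xs → length (runs run xs) ≡ length xs
length-runs run [] = refl
length-runs run (x ∷ xs) = cong suc (length-runs _ xs)

length-allRuns : ∀ (I : Subset n) xs {m} → length xs ≤ m → length (allRuns I xs) ≤ length xs * m
length-allRuns I [] _ = z≤n
length-allRuns I (x ∷ xs) {m} le = begin
  length (runs I (x ∷ xs) ++ allRuns I xs)           ≡⟨ length-++ (runs I (x ∷ xs)) ⟩
  length (runs I (x ∷ xs)) + length (allRuns I xs)   ≤⟨ +-mono-≤ (≤-trans (≤-reflexive (length-runs I (x ∷ xs))) le) (length-allRuns I xs (≤-trans (n≤1+n _) le)) ⟩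
  m + length xs * m                                  ∎
  where open ≤-Reasoning

scan-agree : ∀ {o o′ : Subset n → Bool} s I c run xs →
  (∀ {X} → X ∈ᴸ runs run xs → o′ X ≡ o X) → (∀ {X} → X ∈ᴸ allRuns I xs → o′ X ≡ o X) →
  scan o′ s I c run xs ≡ scan o s I c run xs
scan-agree s I c run [] _ _ = refl
scan-agree {n} {o} {o′} s I c run (x ∷ xs) onRun onAll
  rewrite onRun (here refl) with fresh o run x | suc c <? s
... | false | _     = restart
  where
  restart : scan o′ s I 0 I xs ≡ scan o s I 0 I xs
  restart = scan-agree s I 0 I xs (onAll ∘ first-runs xs) (onAll ∘ ∈-++⁺ʳ (runs I (x ∷ xs)))
    where
    first-runs : ∀ ys {X} → X ∈ᴸ runs I ys → X ∈ᴸ allRuns I (x ∷ ys)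
    first-runs (y ∷ ys) p = ∈-++⁺ʳ (runs I (x ∷ y ∷ ys)) (∈-++⁺ˡ p)
... | true  | yes _ = cong (keep x) (scan-agree s I (suc c) _ xs (onRun ∘ there) (onAll ∘ ∈-++⁺ʳ (runs I (x ∷ xs))))
... | true  | no _  = refl

scan-length : ∀ (o : Subset n → Bool) s I c run xs {ys} → scan o s I c run xs ≡ shrink ys → length ys ≤ length xs
scan-length o s I c run [] refl = z≤n
scan-length o s I c run (x ∷ xs) eq with fresh o run x | suc c <? s
... | false | _     = ≤-trans (scan-length o s I 0 I xs eq) (n≤1+n _)
... | true  | no _  = case eq of λ ()
... | true  | yes _ with scan o s I (suc c) (⁅ x ⁆ ∪ run) xs in eq′
scan-length o s I c run (x ∷ xs) refl | true | yes _ | shrink ys =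
  s≤s (scan-length o s I (suc c) _ xs eq′)

-- The bound `short` is part of the state because the number of queries has to be controlled for
-- arbitrary answers, not only for those of a matroid.
record State (n : ℕ) : Set where
  constructor state
  field
    chosen     : Subset n
    candidates : List (Fin n)
    short      : length candidates ≤ n
open State

afterScan : ∀ (σ : State n) (r : Scan n) → (∀ {ys} → r ≡ shrink ys → length ys ≤ length (candidates σ)) → State n
afterScan σ (grow J) _ = state J (candidates σ) (short σ)
afterScan σ (shrink ys) le = state (chosen σ) ys (≤-trans (le refl) (short σ))

-- Asking about all candidates at once covers the case in which a scan would neither fill a run nor
-- delete anything.
refine : ℕ → (Subset n → Bool) → State n → State n
refine s o σ with o (insertAll (chosen σ) (candidates σ))
... | true = state (insertAll (chosen σ) (candidates σ)) [] z≤n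
... | false = afterScan σ (scan o s (chosen σ) 0 (chosen σ) (candidates σ)) (scan-length o s _ 0 _ (candidates σ))

afterScan-cong : ∀ (σ : State n) {r r′} → r ≡ r′ →
  (le : ∀ {ys} → r ≡ shrink ys → length ys ≤ length (candidates σ))
  (le′ : ∀ {ys} → r′ ≡ shrink ys → length ys ≤ length (candidates σ)) → afterScan σ r le ≡ afterScan σ r′ le′
afterScan-cong σ {grow J} refl le le′ = refl
afterScan-cong σ {shrink ys} refl le le′ = cong (state _ _) (≤-irrelevant _ _)

refineQueries : State n → List (Subset n)
refineQueries (state I xs _) = insertAll I xs ∷ allRuns I xs

refine-agree : ∀ s {o o′ : Subset n → Bool} σ → (∀ {X} → X ∈ᴸ refineQueries σ → o′ X ≡ o X) → refine s o′ σ ≡ refine s o σ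
refine-agree s {o} {o′} (state I xs le) agree rewrite agree (here refl) with o (insertAll I xs)
... | true = refl
... | false = afterScan-cong (state I xs le) (scan-agree s I 0 I xs (agree ∘ there ∘ first-runs xs) (agree ∘ there)) _ _
  where
  first-runs : ∀ ys {X} → X ∈ᴸ runs I ys → X ∈ᴸ allRuns I ys
  first-runs (y ∷ ys) p = ∈-++⁺ˡ p

taggedQueries : Bool → State n → List (Query n)
taggedQueries b σ = map (b ,_) (refineQueries σ)

refineOnce : (b : Bool) → ℕ → (σ : State n) → Protocol n (length (taggedQueries b σ)) (State n) 1
refineOnce b s σ = oneRound (taggedQueries b σ) (λ O → refine s (λ X → O (b , X)) σ)

length-taggedQueries : ∀ b (σ : State n) → length (taggedQueries b σ) ≤ suc (n * n)
length-taggedQueries {n} b σ = ≤-trans (≤-reflexive (length-map (b ,_) (refineQueries σ)))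
  (s≤s (≤-trans (length-allRuns (chosen σ) (candidates σ) (short σ)) (*-monoˡ-≤ n (short σ))))

refineProtocol : Bool → ℕ → State n → Protocol n (suc (n * n)) (State n) 1
refineProtocol b s σ = weaken (length-taggedQueries b σ) (refineOnce b s σ)

eval-refine : ∀ (O : Oracle n) b s σ → eval O (refineProtocol b s σ) ≡ refine s (λ X → O (b , X)) σ
eval-refine O b s σ = trans (eval-weaken O (length-taggedQueries b σ) (refineOnce b s σ))
  (eval-oneRound O (taggedQueries b σ) (λ O → refine s (λ X → O (b , X)) σ)
    λ O′ agree → refine-agree s σ λ p → agree (∈-map⁺ (b ,_) p))

completion : Bool → ℕ → ∀ T → Subset n → Subset n → Protocol n (suc (n * n)) (Subset n) (T * 1)
completion b s T I C = mapᴾ chosen (iterate T (refineProtocol b s) (state I (elements C) (length-elements C)))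

-- Correctness and round count of the completion

module _ (M : Matroid n) where

  Spans : Subset n → Subset n → Set
  Spans X Y = X ⊆ Y × (∀ {B} → IsBasis M X B → IsBasis M Y B)

  spans-trans : ∀ {X Y Z} → Spans X Y → Spans Y Z → Spans X Z
  spans-trans (X⊆Y , f) (Y⊆Z , g) = Y⊆Z ∘ X⊆Y , g ∘ f

  spans-⊇ : ∀ {X Y Z} → X ⊆ Y → Y ⊆ Z → Spans X Z → Spans Y Z
  spans-⊇ X⊆Y Y⊆Z (_ , f) = Y⊆Z , λ β →
    let _ , _ , γ = extend M (indep-∅ M) (λ p → ⊥-elim (∉⊥ p)) in
    largest-basis M (Y⊆Z ∘ within β) (independent β) λ indJ J⊆Z →
      ≤-trans (basis-largest M (f γ) indJ J⊆Z) (basis-largest M β (independent γ) (X⊆Y ∘ within γ))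

  module _ (s : ℕ) (I : Subset n) where

    private
      scanᴹ = scan (indep M) s I

    fresh-true : ∀ {run x} → fresh (indep M) run x ≡ true → x ∉ run × Independent M (⁅ x ⁆ ∪ run)
    fresh-true {run} {x} eq with x ∈? run
    ... | no x∉ = x∉ , eq

    fresh-false : ∀ {run x} → fresh (indep M) run x ≡ false → x ∈ run ⊎ ¬ Independent M (⁅ x ⁆ ∪ run)
    fresh-false {run} {x} eq with x ∈? run
    ... | yes x∈ = inj₁ x∈
    ... | no _ = inj₂ λ ind → case trans (sym ind) eq of λ ()

    scan-grow : ∀ {c run} xs {J} → c < s → Independent M I → Independent M run → I ⊆ run → ∣ run ∣ ≡ ∣ I ∣ + c →
      scanᴹ c run xs ≡ grow J → Independent M J × I ⊆ J × J ⊆ insertAll run xs × ∣ I ∣ + s ≤ ∣ J ∣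
    scan-grow {c} {run} (x ∷ xs) c<s indI ind I⊆ size eq with fresh (indep M) run x in f | suc c <? s
    ... | false | _ =
      let p , q , r , t = scan-grow xs (≤-<-trans z≤n c<s) indI indI id (sym (+-identityʳ _)) eq
      in p , q , insertAll-mono xs (⊆-insert ∘ I⊆) ∘ r , t
    ... | true | yes lt with scanᴹ (suc c) (⁅ x ⁆ ∪ run) xs in eq′
    scan-grow {c} {run} (x ∷ xs) c<s indI ind I⊆ size refl | true | yes lt | grow J =
      let x∉ , ind′ = fresh-true f in
      scan-grow xs lt indI ind′ (⊆-insert ∘ I⊆) (trans (∣insert∣ x∉) (trans (cong suc size) (sym (+-suc _ c)))) eq′
    scan-grow {c} {run} (x ∷ xs) c<s indI ind I⊆ size refl | true | no ≮ =
      let x∉ , ind′ = fresh-true f in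
      ind′ , ⊆-insert ∘ I⊆ , ⊆-insertAll xs ,
      ≤-trans (+-monoʳ-≤ ∣ I ∣ (≮⇒≥ ≮)) (≤-reflexive (sym (trans (∣insert∣ x∉) (trans (cong suc size) (sym (+-suc _ c))))))

    -- A deleted candidate is spanned by its run, and the run consists of `I` and survivors only. In
    -- the induction `X` collects the survivors met so far, so that it still contains the current
    -- run.
    scan-spans : ∀ {c run} xs {ys} → Independent M I → Independent M run → I ⊆ run →
      scanᴹ c run xs ≡ shrink ys → ∀ {X} → run ⊆ X → Spans (insertAll X ys) (insertAll X xs)
    scan-spans [] indI ind I⊆ refl run⊆X = id , id
    scan-spans {c} {run} (x ∷ xs) indI ind I⊆ eq {X} run⊆X with fresh (indep M) run x in f | suc c <? s
    ... | false | _ = spans-trans (scan-spans xs indI indI id eq (run⊆X ∘ I⊆))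
        (insertAll-mono xs ⊆-insert ,
         λ β → subst (λ Y → IsBasis M Y _) (sym (insertAll-insert xs x X))
                 (basis-spanned M ind (⊆-insertAll xs ∘ run⊆X) (fresh-false f) β))
    ... | true | yes _ with scanᴹ (suc c) (⁅ x ⁆ ∪ run) xs in eq′
    scan-spans {c} {run} (x ∷ xs) indI ind I⊆ refl {X} run⊆X | true | yes _ | shrink ys =
      scan-spans xs indI (proj₂ (fresh-true f)) (⊆-insert ∘ I⊆) eq′ (insert-mono run⊆X)

    -- Without deletions the scan is one single run, which ends up containing every candidate.
    scan-independent : ∀ {c run} xs {ys} → Independent M run → scanᴹ c run xs ≡ shrink ys →
      length xs ≤ length ys → Independent M (insertAll run xs)
    scan-independent [] ind _ _ = ind
    scan-independent {c} {run} (x ∷ xs) ind eq le with fresh (indep M) run x in f | suc c <? s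
    ... | false | _ = contradiction (scan-length (indep M) s I 0 I xs eq) (<⇒≱ le)
    ... | true | yes _ with scanᴹ (suc c) (⁅ x ⁆ ∪ run) xs in eq′
    scan-independent (x ∷ xs) ind refl (s≤s le) | true | yes _ | shrink ys =
      scan-independent xs (proj₂ (fresh-true f)) eq′ le

    -- d deletions separate the surviving candidates into d + 1 runs of fewer than s elements.
    scan-deletes : ∀ {c run} xs {ys} → c < s → scanᴹ c run xs ≡ shrink ys →
      ∃ λ d → length ys + d ≡ length xs × length xs + c < s * suc d
    scan-deletes {c} [] c<s refl = 0 , refl , subst (c <_) (sym (*-identityʳ s)) c<s
    scan-deletes {c} {run} (x ∷ xs) c<s eq with fresh (indep M) run x | suc c <? s
    ... | false | _ =
      let d , sum , bound = scan-deletes xs (≤-<-trans z≤n c<s) eq in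
      suc d , trans (+-suc _ d) (cong suc sum) , (begin-strict
        suc (length xs + c)     ≡⟨ +-suc (length xs) c ⟨
        length xs + suc c       <⟨ +-mono-<-≤ (subst (_< s * suc d) (+-identityʳ _) bound) c<s ⟩
        s * suc d + s           ≡⟨ +-comm _ s ⟩
        s + s * suc d           ≡⟨ *-suc s (suc d) ⟨
        s * suc (suc d)         ∎)
      where open ≤-Reasoning
    ... | true | yes lt with scanᴹ (suc c) (⁅ x ⁆ ∪ run) xs in eq′
    scan-deletes {c} (x ∷ xs) c<s refl | true | yes lt | shrink ys =
      let d , sum , bound = scan-deletes xs lt eq′
      in d , cong suc sum , subst (_< s * suc d) (+-suc (length xs) c) bound

  record Valid (P : Subset n) (σ : State n) : Set where
    constructor valid
    field
      chosen-independent : Independent M (chosen σ)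
      spans              : Spans (insertAll (chosen σ) (candidates σ)) P
  open Valid

  data Progress (s : ℕ) (σ σ′ : State n) : Set where
    finished : candidates σ′ ≡ [] → Progress s σ σ′
    grown    : candidates σ′ ≡ candidates σ → ∣ chosen σ ∣ + s ≤ ∣ chosen σ′ ∣ → Progress s σ σ′
    shrunk   : chosen σ′ ≡ chosen σ → ∀ d → length (candidates σ′) + d ≡ length (candidates σ) →
               length (candidates σ) ≤ 2 * s * d → Progress s σ σ′

  independent-basis : ∀ {I} → Independent M I → IsBasis M I I
  independent-basis ind = basis id ind λ x∈ x∉ → ⊥-elim (x∉ x∈)

  refine-progress : ∀ {s P σ} → 1 ≤ s → Valid P σ → Valid P (refine s (indep M) σ) × Progress s σ (refine s (indep M) σ)
  refine-progress {s} {P} {state I xs le} 1≤s (valid indI sp) with indep M (insertAll I xs) in full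
  ... | true = valid full sp , finished refl
  ... | false = scanned (scan-length (indep M) s I 0 I xs)
    where
    ⊆P = proj₁ sp

    -- There is one run more than there are deletions, hence at most twice as many runs as deletions
    -- once something is deleted; this is the factor 2 in `2 * s`.
    enough : ∀ d → length xs < s * suc (suc d) → length xs ≤ 2 * s * suc d
    enough d lt = begin
      length xs             ≤⟨ <⇒≤ lt ⟩
      s * suc (suc d)       ≡⟨ *-suc s (suc d) ⟩
      s + s * suc d         ≤⟨ +-monoˡ-≤ (s * suc d) (m≤m*n s (suc d)) ⟩
      s * suc d + s * suc d ≡⟨ cong (s * suc d +_) (sym (+-identityʳ _)) ⟩
      2 * (s * suc d)       ≡⟨ *-assoc 2 s (suc d) ⟨
      2 * s * suc d         ∎
      where open ≤-Reasoning

    scanned : (le′ : ∀ {ys} → scan (indep M) s I 0 I xs ≡ shrink ys → length ys ≤ length xs) → let σ′ = afterScan (state I xs le) (scan (indep M) s I 0 I xs) le′ in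
              Valid P σ′ × Progress s (state I xs le) σ′
    scanned le′ with scan (indep M) s I 0 I xs in eq
    ... | grow J =
      let indJ , I⊆J , J⊆ , size = scan-grow s I xs 1≤s indI indI id (sym (+-identityʳ _)) eq in
      valid indJ (spans-⊇ (insertAll-mono xs I⊆J)
        (λ z∈ → case ∈-insertAll⁻ xs z∈ of λ where
          (inj₁ z∈J) → ⊆P (J⊆ z∈J)
          (inj₂ z∈xs) → ⊆P (∈-insertAll⁺ z∈xs)) sp) ,
      grown refl size
    ... | shrink ys with scan-deletes s I xs 1≤s eq
    ... | zero , sum , _ = case trans (sym full) (scan-independent s I xs indI eq
            (≤-reflexive (trans (sym sum) (+-identityʳ _)))) of λ ()
    ... | suc d , sum , bound =
      valid indI (spans-trans (scan-spans s I xs indI indI id eq id) sp) ,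
      shrunk refl (suc d) sum (enough d (subst (_< s * suc (suc d)) (+-identityʳ _) bound))

  refine-fixed : ∀ {s I le} → Independent M I → refine s (indep M) (state I [] le) ≡ state I [] z≤n
  refine-fixed ind rewrite ind = refl

  module _ (O : Oracle n) (b : Bool) (O≡ : ∀ X → O (b , X) ≡ indep M X) {s : ℕ} {P : Subset n} (1≤s : 1 ≤ s) where

    private
      s′ = 2 * s

      1≤s′ : 1 ≤ s′
      1≤s′ = ≤-trans 1≤s (m≤m+n s _)

      next : State n → State n
      next σ = eval O (refineProtocol b s σ)

      next≡ : ∀ σ → next σ ≡ refine s (indep M) σ
      next≡ σ = trans (eval-refine O b s σ) (refine-agree s σ λ {X} _ → O≡ X)

      after : ℕ → State n → State n
      after t σ = eval O (iterate t (refineProtocol b s) σ)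

      after-suc : ∀ t σ → after (suc t) σ ≡ after t (refine s (indep M) σ)
      after-suc t σ = trans (eval-iterate O t (refineProtocol b s) σ) (cong (after t) (next≡ σ))

      after-fixed : ∀ t {I le} → Independent M I → ∃ λ le′ → after t (state I [] le) ≡ state I [] le′
      after-fixed zero ind = _ , refl
      after-fixed (suc t) {I} {le} ind =
        let le′ , eq = after-fixed t ind
        in le′ , trans (after-suc t (state I [] le)) (trans (cong (after t) (refine-fixed ind)) eq)

      finished-basis : ∀ t σ → candidates σ ≡ [] → Valid P σ → IsBasis M P (chosen (after t σ))
      finished-basis t (state I [] le) refl (valid ind sp) =
        let _ , eq = after-fixed t ind
        in subst (IsBasis M P ∘ chosen) (sym eq) (proj₂ sp (independent-basis ind))

    -- The number N of candidates satisfies 2sN < (2s + c) 2^h: after 2s shrinking rounds it is halved.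
    refine-terminates : ∀ t h c β σ → Valid P σ → s′ * length (candidates σ) < (s′ + c) * 2 ^ h → c ≤ s′ →
      (∀ {J} → Independent M J → J ⊆ P → ∣ J ∣ ≤ ∣ chosen σ ∣ + s * β) →
      s′ * h + c + β ≤ t → IsBasis M P (chosen (after t σ))
    refine-terminates t zero zero β σ@(state I xs _) v small _ rank-bound budget =
      finished-basis t σ (empty xs (*-cancelˡ-< s′ _ _ (subst (s′ * length xs <_) (cong (_* 1) (+-identityʳ s′)) small))) v
      where
      empty : ∀ (xs : List (Fin n)) → length xs < 1 → xs ≡ []
      empty [] _ = refl
      empty (_ ∷ _) (s≤s ())
    -- A phase is over: halving the power of two doubles the other factor, which provides `s′` new
    -- rounds.
    refine-terminates t (suc h) zero β σ v small _ rank-bound budget =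
      refine-terminates t h s′ β σ v (subst (s′ * length (candidates σ) <_) double small) ≤-refl rank-bound
        (subst (_≤ t) (cong (_+ β) (trans (+-identityʳ _) (trans (*-suc s′ h) (+-comm s′ _)))) budget)
      where
      double : (s′ + 0) * 2 ^ suc h ≡ (s′ + s′) * 2 ^ h
      double = trans (cong (_* 2 ^ suc h) (+-identityʳ s′)) (trans (sym (*-assoc s′ 2 (2 ^ h)))
        (cong (_* 2 ^ h) (trans (*-comm s′ 2) (cong (s′ +_) (+-identityʳ s′)))))
    refine-terminates zero h (suc c) β σ v small _ rank-bound budget =
      case ≤-trans (≤-trans (m≤n+m (suc c) (s′ * h)) (m≤m+n _ β)) budget of λ ()
    refine-terminates (suc t) h (suc c) β σ v small c≤ rank-bound budget
      with refine-progress 1≤s v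
    ... | v′ , progress rewrite after-suc t σ = continue progress
      where
      σ′ = refine s (indep M) σ
      N = length (candidates σ)
      budget′ : s′ * h + c + β ≤ t
      budget′ = s≤s⁻¹ (subst (_≤ suc t) (cong (_+ β) (+-suc (s′ * h) c)) budget)

      continue : Progress s σ σ′ → IsBasis M P (chosen (after t σ′))
      continue (finished done′) = finished-basis t σ′ done′ v′
      continue (shrunk same d sum N≤) = refine-terminates t h c β σ′ v′ fewer (≤-trans (n≤1+n c) c≤)
        (λ {J} ind J⊆ → subst (λ I → ∣ J ∣ ≤ ∣ I ∣ + s * β) (sym same) (rank-bound ind J⊆)) budget′
        where
        open ≤-Reasoning
        N′ = length (candidates σ′)
        fewer : s′ * N′ < (s′ + c) * 2 ^ h
        -- As long as `N` is at least `2 ^ h`, the deletions lower `s′ * N` by at least `N ≥ 2 ^ h`,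
        -- which pays for the decrease of `c`. Below `2 ^ h` the bound holds for any `c`.
        fewer with 2 ^ h ≤? N
        ... | yes 2^h≤N = +-cancelʳ-< (2 ^ h) _ _ (begin-strict
          s′ * N′ + 2 ^ h            ≤⟨ +-monoʳ-≤ (s′ * N′) (≤-trans 2^h≤N N≤) ⟩
          s′ * N′ + s′ * d           ≡⟨ *-distribˡ-+ s′ N′ d ⟨
          s′ * (N′ + d)              ≡⟨ cong (s′ *_) sum ⟩
          s′ * N                     <⟨ small ⟩
          (s′ + suc c) * 2 ^ h       ≡⟨ cong (_* 2 ^ h) (+-suc s′ c) ⟩
          2 ^ h + (s′ + c) * 2 ^ h   ≡⟨ +-comm (2 ^ h) _ ⟩
          (s′ + c) * 2 ^ h + 2 ^ h   ∎)
        ... | no N<2^h = begin-strict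
          s′ * N′          ≤⟨ *-monoʳ-≤ s′ (≤-trans (m≤m+n N′ d) (≤-reflexive sum)) ⟩
          s′ * N           <⟨ *-monoʳ-< s′ ⦃ >-nonZero 1≤s′ ⦄ (≰⇒> N<2^h) ⟩
          s′ * 2 ^ h       ≤⟨ *-monoˡ-≤ (2 ^ h) (m≤m+n s′ c) ⟩
          (s′ + c) * 2 ^ h ∎
      -- A growing round is charged to `β` instead of `c`: it uses up `s` of the at most `s * β`
      -- elements still missing from a basis of `P`.
      continue (grown same size) = enlarge β rank-bound budget
        where
        enlarge : ∀ β → (∀ {J} → Independent M J → J ⊆ P → ∣ J ∣ ≤ ∣ chosen σ ∣ + s * β) →
                  s′ * h + suc c + β ≤ suc t → IsBasis M P (chosen (after t σ′))
        enlarge zero rank-bound _ = contradiction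
          (≤-trans size (rank-bound (Valid.chosen-independent v′) (proj₁ (Valid.spans v′) ∘ ⊆-insertAll (candidates σ′))))
          (<⇒≱ (+-monoʳ-< ∣ chosen σ ∣ (subst (_< s) (sym (*-zeroʳ s)) 1≤s)))
        enlarge (suc β) rank-bound budget = refine-terminates t h (suc c) β σ′ v′
          (subst (λ xs → s′ * length xs < (s′ + suc c) * 2 ^ h) (sym same) small) c≤
          (λ {J} ind J⊆ → begin
            ∣ J ∣                        ≤⟨ rank-bound ind J⊆ ⟩
            ∣ chosen σ ∣ + s * suc β     ≡⟨ cong (∣ chosen σ ∣ +_) (*-suc s β) ⟩
            ∣ chosen σ ∣ + (s + s * β)   ≡⟨ +-assoc ∣ chosen σ ∣ s (s * β) ⟨
            ∣ chosen σ ∣ + s + s * β     ≤⟨ +-monoˡ-≤ (s * β) size ⟩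
            ∣ chosen σ′ ∣ + s * β        ∎)
          (s≤s⁻¹ (subst (_≤ suc t) (+-suc _ β) budget))
          where open ≤-Reasoning

  completion-basis : ∀ (O : Oracle n) b → (∀ X → O (b , X) ≡ indep M X) → ∀ {s h β T I C} → 1 ≤ s → n < 2 ^ h →
    2 * s * h + β ≤ T → Independent M I → (∀ {J} → Independent M J → J ⊆ I ∪ C → ∣ J ∣ ≤ ∣ I ∣ + s * β) →
    IsBasis M (I ∪ C) (eval O (completion b s T I C))
  completion-basis O b O≡ {s} {h} {β} {T} {I} {C} 1≤s n<2^h budget indI rank-bound =
    subst (IsBasis M (I ∪ C)) (sym (eval-map O chosen (iterate T (refineProtocol b s) σ)))
      (refine-terminates O b O≡ 1≤s T h 0 β σ
        (valid indI (subst (λ X → Spans X (I ∪ C)) (sym (insertAll-elements I C)) (id , id)))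
        small z≤n rank-bound (subst (λ z → z + β ≤ T) (sym (+-identityʳ (2 * s * h))) budget))
    where
    σ = state I (elements C) (length-elements C)
    open ≤-Reasoning
    small : 2 * s * length (elements C) < (2 * s + 0) * 2 ^ h
    small = begin-strict
      2 * s * length (elements C) ≤⟨ *-monoʳ-≤ (2 * s) (length-elements C) ⟩
      2 * s * n                   <⟨ *-monoʳ-< (2 * s) ⦃ >-nonZero (≤-trans 1≤s (m≤m+n s _)) ⦄ n<2^h ⟩
      2 * s * 2 ^ h               ≡⟨ cong (_* 2 ^ h) (+-identityʳ (2 * s)) ⟨
      (2 * s + 0) * 2 ^ h         ∎

-- Weights and parallel greedy selection

∣∪∣≤ : ∀ (A B : Subset n) → ∣ A ∪ B ∣ ≤ ∣ A ∣ + ∣ B ∣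
∣∪∣≤ [] [] = z≤n
∣∪∣≤ (true ∷ A) (false ∷ B) = s≤s (∣∪∣≤ A B)
∣∪∣≤ (false ∷ A) (false ∷ B) = ∣∪∣≤ A B
∣∪∣≤ (true ∷ A) (true ∷ B) = s≤s (≤-trans (∣∪∣≤ A B) (+-monoʳ-≤ ∣ A ∣ (n≤1+n _)))
∣∪∣≤ (false ∷ A) (true ∷ B) = ≤-trans (s≤s (∣∪∣≤ A B)) (≤-reflexive (sym (+-suc _ _)))

firstOf : ℕ → Subset n → Subset n
firstOf _       []          = []
firstOf zero    (_ ∷ X)     = false ∷ firstOf zero X
firstOf (suc k) (true ∷ X)  = true ∷ firstOf k X
firstOf (suc k) (false ∷ X) = false ∷ firstOf (suc k) X

firstOf-⊆ : ∀ k (X : Subset n) → firstOf k X ⊆ X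
firstOf-⊆ zero (_ ∷ X) (there p) = there (firstOf-⊆ zero X p)
firstOf-⊆ (suc k) (true ∷ X) here = here
firstOf-⊆ (suc k) (true ∷ X) (there p) = there (firstOf-⊆ k X p)
firstOf-⊆ (suc k) (false ∷ X) (there p) = there (firstOf-⊆ (suc k) X p)

∣firstOf∣ : ∀ k (X : Subset n) → k ≤ ∣ X ∣ → ∣ firstOf k X ∣ ≡ k
∣firstOf∣ zero [] _ = refl
∣firstOf∣ zero (_ ∷ X) _ = ∣firstOf∣ zero X z≤n
∣firstOf∣ (suc k) (true ∷ X) (s≤s le) = cong suc (∣firstOf∣ k X le)
∣firstOf∣ (suc k) (false ∷ X) le = ∣firstOf∣ (suc k) X le

total : Subset n → (Fin n → ℕ) → ℕ
total [] w = 0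
total (true ∷ S) w = w zero + total S (w ∘ suc)
total (false ∷ S) w = total S (w ∘ suc)

total-mono : ∀ (S : Subset n) {v w} → (∀ {x} → x ∈ S → v x ≤ w x) → total S v ≤ total S w
total-mono [] le = z≤n
total-mono (true ∷ S) le = +-mono-≤ (le here) (total-mono S (le ∘ there))
total-mono (false ∷ S) le = total-mono S (le ∘ there)

total-cong : ∀ (S : Subset n) {v w} → (∀ {x} → x ∈ S → v x ≡ w x) → total S v ≡ total S w
total-cong S eq = ≤-antisym (total-mono S (≤-reflexive ∘ eq)) (total-mono S (≤-reflexive ∘ sym ∘ eq))

total-+ : ∀ (S : Subset n) v w → total S (λ x → v x + w x) ≡ total S v + total S w
total-+ [] v w = refl
total-+ (false ∷ S) v w = total-+ S (v ∘ suc) (w ∘ suc)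
total-+ (true ∷ S) v w = begin
  v zero + w zero + total S (λ x → v (suc x) + w (suc x)) ≡⟨ cong (v zero + w zero +_) (total-+ S (v ∘ suc) (w ∘ suc)) ⟩
  v zero + w zero + (V + W)                               ≡⟨ +-assoc (v zero) (w zero) (V + W) ⟩
  v zero + (w zero + (V + W))                             ≡⟨ cong (v zero +_) (trans (sym (+-assoc (w zero) V W)) (trans (cong (_+ W) (+-comm (w zero) V)) (+-assoc V (w zero) W))) ⟩
  v zero + (V + (w zero + W))                             ≡⟨ +-assoc (v zero) V (w zero + W) ⟨
  v zero + V + (w zero + W)                               ∎
  where
  open ≡-Reasoning
  V = total S (v ∘ suc)
  W = total S (w ∘ suc)

total-const : ∀ (S : Subset n) k → total S (λ _ → k) ≡ ∣ S ∣ * k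
total-const [] k = refl
total-const (true ∷ S) k = cong (k +_) (total-const S k)
total-const (false ∷ S) k = total-const S k

total-split : ∀ (S U : Subset n) w → total S w ≡ total (S ∩ U) w + total (S ─ U) w
total-split [] [] w = refl
total-split (false ∷ S) (false ∷ U) w = total-split S U (w ∘ suc)
total-split (false ∷ S) (true ∷ U) w = total-split S U (w ∘ suc)
total-split (true ∷ S) (true ∷ U) w = trans (cong (w zero +_) (total-split S U (w ∘ suc))) (sym (+-assoc (w zero) _ _))
total-split (true ∷ S) (false ∷ U) w = begin
  w zero + total S (w ∘ suc) ≡⟨ cong (w zero +_) (total-split S U (w ∘ suc)) ⟩
  w zero + (A + B)           ≡⟨ +-assoc (w zero) A B ⟨
  w zero + A + B             ≡⟨ cong (_+ B) (+-comm (w zero) A) ⟩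
  A + w zero + B             ≡⟨ +-assoc A (w zero) B ⟩
  A + (w zero + B)           ∎
  where
  open ≡-Reasoning
  A = total (S ∩ U) (w ∘ suc)
  B = total (S ─ U) (w ∘ suc)

bit : Bool → ℕ
bit b = if b then 1 else 0

total-bit : ∀ (S U : Subset n) → total S (bit ∘ lookup U) ≡ ∣ S ∩ U ∣
total-bit [] [] = refl
total-bit (false ∷ S) (_ ∷ U) = total-bit S U
total-bit (true ∷ S) (true ∷ U) = cong suc (total-bit S U)
total-bit (true ∷ S) (false ∷ U) = total-bit S U

∈-bit : ∀ {x : Fin n} {U} → x ∈ U → bit (lookup U x) ≡ 1
∈-bit x∈U = cong bit ([]=⇒lookup x∈U)

∉-bit : ∀ {x : Fin n} {U} → x ∉ U → bit (lookup U x) ≡ 0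
∉-bit {x = x} {U} x∉U with lookup U x in eq
... | true = ⊥-elim (x∉U (lookup⇒[]= x U eq))
... | false = refl

total-layer : ∀ (S : Subset n) w j → total S (λ x → w x ⊓ suc j) ≡ total S (λ x → w x ⊓ j) + ∣ S ∩ level w (suc j) ∣
total-layer S w j = begin
  total S (λ x → w x ⊓ suc j)                                    ≡⟨ total-cong S (λ {x} _ → layer x) ⟩
  total S (λ x → w x ⊓ j + bit (lookup (level w (suc j)) x))     ≡⟨ total-+ S (λ x → w x ⊓ j) _ ⟩
  total S (λ x → w x ⊓ j) + total S (bit ∘ lookup (level w (suc j))) ≡⟨ cong (total S (λ x → w x ⊓ j) +_) (total-bit S (level w (suc j))) ⟩
  total S (λ x → w x ⊓ j) + ∣ S ∩ level w (suc j) ∣              ∎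
  where
  open ≡-Reasoning
  layer : ∀ x → w x ⊓ suc j ≡ w x ⊓ j + bit (lookup (level w (suc j)) x)
  layer x with suc j ≤? w x
  ... | yes lt = trans (m≥n⇒m⊓n≡n lt) (trans (sym (+-comm j 1))
          (cong₂ _+_ (sym (m≥n⇒m⊓n≡n (<⇒≤ lt))) (sym (∈-bit (∈-level⁺ w lt)))))
  ... | no ≰ = let le = s≤s⁻¹ (≰⇒> ≰) in
          trans (m≤n⇒m⊓n≡m (m≤n⇒m≤1+n le)) (trans (sym (+-identityʳ _))
            (cong₂ _+_ (sym (m≤n⇒m⊓n≡m le)) (sym (∉-bit (≰ ∘ ∈-level⁻ w {suc j})))))

-- The weight of a set is the sum of the sizes of its parts in the level sets 1 up to `L`, and in
-- each of these `S` has the largest possible part.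
level-basis-heaviest : ∀ (M : Matroid n) {w S T L} → (∀ x → w x ≤ L) → LevelBasis M w S → Independent M T →
  total T w ≤ total S w
level-basis-heaviest M {w} {S} {T} {L} w≤L lb indT = begin
  total T w               ≡⟨ total-cong T (λ {x} _ → m≤n⇒m⊓n≡m (w≤L x)) ⟨
  total T (λ x → w x ⊓ L) ≤⟨ layers L ⟩
  total S (λ x → w x ⊓ L) ≡⟨ total-cong S (λ {x} _ → m≤n⇒m⊓n≡m (w≤L x)) ⟩
  total S w               ∎
  where
  open ≤-Reasoning
  layers : ∀ j → total T (λ x → w x ⊓ j) ≤ total S (λ x → w x ⊓ j)
  layers zero = ≤-trans (≤-reflexive (trans (total-cong T (λ {x} _ → ⊓-zeroʳ (w x))) (trans (total-const T 0) (*-zeroʳ ∣ T ∣)))) z≤n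
  layers (suc j) = begin
    total T (λ x → w x ⊓ suc j)                       ≡⟨ total-layer T w j ⟩
    total T (λ x → w x ⊓ j) + ∣ T ∩ level w (suc j) ∣ ≤⟨ +-mono-≤ (layers j) (basis-largest M (level-basis M lb (s≤s z≤n))
                                                          (indep-⊆ M (p∩q⊆p T _) indT) (p∩q⊆q T _)) ⟩
    total S (λ x → w x ⊓ j) + ∣ S ∩ level w (suc j) ∣ ≡⟨ total-layer S w j ⟨
    total S (λ x → w x ⊓ suc j)                       ∎

selectionBit : Bool → ℕ → ∀ T → Subset n → Subset n → Fin n → Protocol n (suc (n * n)) Bool (T * 1 + 1)
selectionBit b s T I C x = bind (completion b s T I C) λ B → weaken (s≤s z≤n) (query (b , ⁅ x ⁆ ∪ B))

selection : Bool → ℕ → ∀ T → (I C : Fin n → Subset n) → Subset n → Protocol n (n * suc (n * n)) (Subset n) (T * 1 + 1)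
selection b s T I C V = mapᴾ (V ∩_) (parallel λ x → selectionBit b s T (I x) (C x) x)

eval-selection : ∀ (O : Oracle n) b s T (I C : Fin n → Subset n) V → eval O (selection b s T I C V) ≡
  V ∩ tabulate (λ x → O (b , ⁅ x ⁆ ∪ eval O (completion b s T (I x) (C x))))
eval-selection {n} O b s T I C V = trans (eval-map O (V ∩_) (parallel λ x → selectionBit b s T (I x) (C x) x))
  (cong (V ∩_) (trans (eval-parallel O (λ x → selectionBit b s T (I x) (C x) x)) (tabulate-cong bits)))
  where
  bits : ∀ x → eval O (selectionBit b s T (I x) (C x) x) ≡ O (b , ⁅ x ⁆ ∪ eval O (completion b s T (I x) (C x)))
  bits x = trans (eval-bind O (completion b s T (I x) (C x)) _) (eval-weaken O (s≤s (z≤n {n * n})) (query (b , ⁅ x ⁆ ∪ eval O (completion b s T (I x) (C x)))))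

module _ (M : Matroid n) (O : Oracle n) (b : Bool) (O≡ : ∀ X → O (b , X) ≡ indep M X)
         {s h β T : ℕ} (1≤s : 1 ≤ s) (n<2^h : n < 2 ^ h) (budget : 2 * s * h + β ≤ T) where

  -- The basis that `IsGreedy` asks for at `x` is the one completed for `x` alone; the bases found
  -- for different elements need not be nested.
  selection-greedy : ∀ {V w A} {I C : Fin n → Subset n} (K : PriorityKey w) → let open PriorityKey K in
    (∀ x → Independent M (I x)) → (∀ x → I x ∪ C x ≡ A ∪ before V K (key x)) →
    (∀ x {J} → Independent M J → J ⊆ I x ∪ C x → ∣ J ∣ ≤ ∣ I x ∣ + s * β) →
    IsGreedy V K M A (eval O (selection b s T I C V))
  selection-greedy {V} {w} {A} {I} {C} K indI eq rank-bound rewrite eval-selection O b s T I C V = record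
    { selected-⊆ = p∩q⊆p V _
    ; selects = λ {x} x∈V → B x
        , subst (λ X → IsBasis M X (B x)) (eq x) (completion-basis M O b O≡ 1≤s n<2^h budget (indI x) (rank-bound x))
        , (λ x∈G → trans (sym (O≡ _)) (tabulate-∈⁻ (p∩q⊆q V _ x∈G)))
        , (λ x∉G ind → x∉G (x∈p∩q⁺ (x∈V , tabulate-∈⁺ (trans (O≡ _) ind))))
    }
    where
    B : Fin n → Subset n
    B x = eval O (completion b s T (I x) (C x))

-- The auction

record Auction (n : ℕ) : Set where
  constructor auction
  field
    w₁ w₂ : Fin n → ℕ
    S₁ S₂ : Subset n

unmatched : Auction n → ℕ
unmatched (auction _ _ S₁ S₂) = ∣ S₁ ─ S₂ ∣

start : ℕ → Subset n → Auction n
start L B = auction (λ _ → L) (λ _ → 0) B ⊥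

-- The truncation bounds the new weights in every state, so the algorithm can form priority keys
-- without a proof of the invariant. Under the invariant the bidders' weights change by exactly one.
raise lower : ℕ → Subset n → (Fin n → ℕ) → Fin n → ℕ
raise L D w x = (if does (x ∈? D) then suc (w x) else w x) ⊓ L
lower L D w x = (if does (x ∈? D) then w x ∸ 1 else w x) ⊓ L

raise-in : ∀ {L D} {w : Fin n → ℕ} {x} → x ∈ D → suc (w x) ≤ L → raise L D w x ≡ suc (w x)
raise-in {D = D} {x = x} x∈D le with x ∈? D
... | yes _ = m≤n⇒m⊓n≡m le
... | no x∉D = ⊥-elim (x∉D x∈D)

raise-out : ∀ {L D} {w : Fin n → ℕ} {x} → x ∉ D → w x ≤ L → raise L D w x ≡ w x
raise-out {D = D} {x = x} x∉D le with x ∈? D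
... | yes x∈D = ⊥-elim (x∉D x∈D)
... | no _ = m≤n⇒m⊓n≡m le

lower-in : ∀ {L D} {w : Fin n → ℕ} {x} → x ∈ D → 1 ≤ w x → w x ≤ L → suc (lower L D w x) ≡ w x
lower-in {L = L} {D} {w} {x} x∈D pos le with x ∈? D
... | yes _ = trans (cong suc (m≤n⇒m⊓n≡m (≤-trans (m∸n≤m (w x) 1) le))) (m+[n∸m]≡n pos)
... | no x∉D = ⊥-elim (x∉D x∈D)

lower-out : ∀ {L D} {w : Fin n → ℕ} {x} → x ∉ D → w x ≤ L → lower L D w x ≡ w x
lower-out {D = D} {x = x} x∉D le with x ∈? D
... | yes x∈D = ⊥-elim (x∉D x∈D)
... | no _ = m≤n⇒m⊓n≡m le

raise-≤ : ∀ L D (w : Fin n → ℕ) x → raise L D w x ≤ L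
raise-≤ L D w x = m⊓n≤n _ L

lower-≤ : ∀ L D (w : Fin n → ℕ) x → lower L D w x ≤ L
lower-≤ L D w x = m⊓n≤n _ L

module _ (L δ s T : ℕ) where

  roundRaise roundLower bidders : Auction n → Subset n
  bidders (auction w₁ w₂ S₁ S₂) = firstOf δ (S₁ ─ S₂)
  roundRaise σ@(auction w₁ w₂ _ _) = ⟨ (λ x → (x ∈? bidders σ) ×-dec (w₁ x + w₂ x ≟ L)) ⟩
  roundLower σ = bidders σ ─ roundRaise σ

  selectionQueries : ℕ → ℕ
  selectionQueries n = n * suc (n * n)

  -- The greedy choice over `S₂ ∪ D` is made afresh, but in each prefix the part from `S₂` is known
  -- to be independent and only the bidders remain to be tested.
  module Raise (σ : Auction n) where
    open Auction σ
    D = roundRaise σ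
    w′ = raise L D w₂
    K = priorityKey L w′ (raise-≤ L D w₂)
    V = S₂ ∪ D
    known cand : Fin n → Subset n
    known x = S₂ ∩ before V K (PriorityKey.key K x)
    cand x = D ∩ before V K (PriorityKey.key K x)
    protocol : Protocol n (selectionQueries n) (Subset n) (T * 1 + 1)
    protocol = selection true s T known cand V

  -- Every element of positive weight outside `A` competes for the places of the lowered bidders,
  -- including these themselves. Candidates may be numerous, but few of them fit, so the completion
  -- has few growing rounds.
  module Lower (σ : Auction n) where
    open Auction σ
    D = roundLower σ
    w′ = lower L D w₁
    K = priorityKey L w′ (lower-≤ L D w₁)
    A = S₁ ─ D
    V = ⟨ (λ x → ¬? (x ∈? A) ×-dec (1 ≤? w′ x)) ⟩
    known cand : Fin n → Subset n
    known x = A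
    cand x = before V K (PriorityKey.key K x)
    protocol : Protocol n (selectionQueries n) (Subset n) (T * 1 + 1)
    protocol = selection false s T known cand V

  bid : Auction n → Subset n × Subset n → Auction n
  bid σ (G₂ , G₁) = auction (Lower.w′ σ) (Raise.w′ σ) (Lower.A σ ∪ G₁) G₂

  bidIf : Bool → Auction n → Protocol n (selectionQueries n + selectionQueries n) (Auction n) (T * 1 + 1)
  bidIf true  σ = mapᴾ (bid σ) (both (Raise.protocol σ) (Lower.protocol σ))
  bidIf false σ = idle (T * 1 + 1) σ

  auctionRound : Auction n → Protocol n (selectionQueries n + selectionQueries n) (Auction n) (T * 1 + 1)
  auctionRound σ = bidIf (does (δ ≤? unmatched σ)) σ

  module _ (M₁ M₂ : Matroid n) where

    private
      O = ask M₁ M₂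

      afterRounds : ℕ → Auction n → Auction n
      afterRounds N σ = eval O (iterate N auctionRound σ)

    record AuctionInvariant (σ : Auction n) : Set where
      open Auction σ
      field
        basis₁ : LevelBasis M₁ w₁ S₁
        basis₂ : LevelBasis M₂ w₂ S₂
        nested : S₂ ⊆ S₁
        w₁≤L   : ∀ x → w₁ x ≤ L
        w₂≤L   : ∀ x → w₂ x ≤ L
        sum    : ∀ x → w₁ x + w₂ x ≡ L ⊎ w₁ x + w₂ x ≡ suc L

    potential : Auction n → ℕ
    potential (auction w₁ w₂ _ _) = total ⊤ (λ x → w₂ x + (L ∸ w₁ x))

    potential-bounded : ∀ {σ} → AuctionInvariant σ → potential σ ≤ n * (L + L)
    potential-bounded {auction w₁ w₂ S₁ S₂} inv = begin
      total ⊤ (λ x → w₂ x + (L ∸ w₁ x)) ≤⟨ total-mono ⊤ (λ {x} _ → +-mono-≤ (w₂≤L x) (m∸n≤m L (w₁ x))) ⟩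
      total {n} ⊤ (λ _ → L + L)         ≡⟨ total-const {n} ⊤ (L + L) ⟩
      ∣ ⊤ {n} ∣ * (L + L)               ≡⟨ cong (_* (L + L)) (∣⊤∣≡n n) ⟩
      n * (L + L)                       ∎
      where
      open ≤-Reasoning
      open AuctionInvariant inv

    module _ {h β : ℕ} (1≤s : 1 ≤ s) (n<2^h : n < 2 ^ h) (budget : 2 * s * h + β ≤ T) (δ≤ : δ ≤ s * β) where

      module BidStep (σ : Auction n) (inv : AuctionInvariant σ) (enough : δ ≤ unmatched σ) where
        open Auction σ
        open AuctionInvariant inv

        D = bidders σ
        D₂ = Raise.D σ
        D₁ = Lower.D σ

        raised? : ∀ x → Dec (x ∈ D × w₁ x + w₂ x ≡ L)
        raised? x = (x ∈? D) ×-dec (w₁ x + w₂ x ≟ L)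

        D⊆S₁ : D ⊆ S₁
        D⊆S₁ p = proj₁ (∈-─⁻ S₁ S₂ (firstOf-⊆ δ (S₁ ─ S₂) p))

        D∌S₂ : ∀ {x} → x ∈ D → x ∉ S₂
        D∌S₂ p = proj₂ (∈-─⁻ S₁ S₂ (firstOf-⊆ δ (S₁ ─ S₂) p))

        ∣D∣≤ : ∣ D ∣ ≤ s * β
        ∣D∣≤ = ≤-trans (≤-reflexive (∣firstOf∣ δ (S₁ ─ S₂) enough)) δ≤

        D₂⊆D : D₂ ⊆ D
        D₂⊆D p = proj₁ (∈⟨⟩⁻ raised? p)

        D₁⊆D : D₁ ⊆ D
        D₁⊆D = p─q⊆p D D₂

        sum-D₂ : ∀ {x} → x ∈ D₂ → w₁ x + w₂ x ≡ L
        sum-D₂ p = proj₂ (∈⟨⟩⁻ raised? p)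

        sum-D₁ : ∀ {x} → x ∈ D₁ → w₁ x + w₂ x ≡ suc L
        sum-D₁ {x} p with ∈-─⁻ D D₂ p | sum x
        ... | x∈D , x∉D₂ | inj₁ eq = ⊥-elim (x∉D₂ (∈⟨⟩⁺ raised? (x∈D , eq)))
        ... | _ | inj₂ eq = eq

        D₂∌D₁ : ∀ {x} → x ∈ D₂ → x ∉ D₁
        D₂∌D₁ x∈D₂ x∈D₁ = proj₂ (∈-─⁻ D D₂ x∈D₁) x∈D₂

        raise-on : ∀ {x} → x ∈ D₂ → Raise.w′ σ x ≡ suc (w₂ x)
        -- The bidder lies in `S₁` and so has `w₁ x` at least 1; the sum `L` then leaves room to
        -- raise `w₂ x`.
        raise-on {x} p = raise-in {w = w₂} p
          (≤-trans (+-monoˡ-≤ (w₂ x) (positive basis₁ (D⊆S₁ (D₂⊆D p)))) (≤-reflexive (sum-D₂ p)))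

        raise-off : ∀ {x} → x ∉ D₂ → Raise.w′ σ x ≡ w₂ x
        raise-off {x} p = raise-out {w = w₂} p (w₂≤L x)

        lower-on : ∀ {x} → x ∈ D₁ → suc (Lower.w′ σ x) ≡ w₁ x
        lower-on {x} p = lower-in {w = w₁} p (positive basis₁ (D⊆S₁ (D₁⊆D p))) (w₁≤L x)

        lower-off : ∀ {x} → x ∉ D₁ → Lower.w′ σ x ≡ w₁ x
        lower-off {x} p = lower-out {w = w₁} p (w₁≤L x)

        G₂ = eval O (Raise.protocol σ)
        G₁ = eval O (Lower.protocol σ)

        greedy₂ : IsGreedy (Raise.V σ) (Raise.K σ) M₂ ⊥ G₂
        greedy₂ = selection-greedy M₂ O true (λ _ → refl) 1≤s n<2^h budget K
          (λ x → indep-⊆ M₂ (p∩q⊆p S₂ _) (level-independent basis₂))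
          (λ x → ⊆-antisym
            (∪-⊆ (∈-∪ʳ ⊥ ∘ p∩q⊆q S₂ _) (∈-∪ʳ ⊥ ∘ p∩q⊆q D₂ _))
            (∪-⊆ (⊥-elim ∘ ∉⊥) λ p → case x∈p∪q⁻ S₂ D₂ (proj₁ (∈-before⁻ V K {PriorityKey.key K x} p)) of λ where
              (inj₁ q) → ∈-∪ˡ _ (x∈p∩q⁺ (q , p))
              (inj₂ q) → ∈-∪ʳ (known x) (x∈p∩q⁺ (q , p))))
          (λ x {J} _ J⊆ → begin
            ∣ J ∣                     ≤⟨ p⊆q⇒∣p∣≤∣q∣ J⊆ ⟩
            ∣ known x ∪ cand x ∣      ≤⟨ ∣∪∣≤ (known x) (cand x) ⟩
            ∣ known x ∣ + ∣ cand x ∣  ≤⟨ +-monoʳ-≤ ∣ known x ∣ (≤-trans (p⊆q⇒∣p∣≤∣q∣ (D₂⊆D ∘ p∩q⊆p D₂ _)) ∣D∣≤) ⟩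
            ∣ known x ∣ + s * β       ∎)
          where
          open Raise σ using (V; K; known; cand)
          open ≤-Reasoning

        greedy₁ : IsGreedy (Lower.V σ) (Lower.K σ) M₁ (Lower.A σ) G₁
        greedy₁ = selection-greedy M₁ O false (λ _ → refl) 1≤s n<2^h budget K
          (λ x → indep-⊆ M₁ (p─q⊆p S₁ D₁) (level-independent basis₁))
          (λ x → refl)
          -- Weights in M₁ only fall, so all competitors lie in the old level set 1, of which `S₁`
          -- is a basis. The rank therefore exceeds `∣ A ∣` by at most the number of lowered
          -- bidders.
          (λ x {J} indJ J⊆ → begin
            ∣ J ∣                      ≤⟨ basis-largest M₁ (level-basis M₁ basis₁ (s≤s z≤n)) indJ (J⊆U x J⊆) ⟩
            ∣ S₁ ∩ level w₁ 1 ∣        ≤⟨ ∣p∩q∣≤∣p∣ S₁ _ ⟩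
            ∣ S₁ ∣                     ≡⟨ trans (∣split∣ S₁ D₁) (+-comm _ ∣ A ∣) ⟩
            ∣ A ∣ + ∣ S₁ ∩ D₁ ∣        ≤⟨ +-monoʳ-≤ ∣ A ∣ (≤-trans (p⊆q⇒∣p∣≤∣q∣ (D₁⊆D ∘ p∩q⊆q S₁ D₁)) ∣D∣≤) ⟩
            ∣ A ∣ + s * β              ∎)
          where
          open Lower σ using (V; K; A; w′; cand)
          open ≤-Reasoning
          w′≤w₁ : ∀ x → w′ x ≤ w₁ x
          w′≤w₁ x = case x ∈? D₁ of λ where
            (yes p) → subst (w′ x ≤_) (lower-on p) (n≤1+n _)
            (no p) → ≤-reflexive (lower-off p)
          J⊆U : ∀ x {J} → J ⊆ A ∪ cand x → J ⊆ level w₁ 1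
          J⊆U x J⊆ {z} p with x∈p∪q⁻ A _ (J⊆ p)
          ... | inj₁ q = ∈-level⁺ w₁ (positive basis₁ (p─q⊆p S₁ D₁ q))
          ... | inj₂ q = ∈-level⁺ w₁ (≤-trans
            (proj₂ (∈⟨⟩⁻ (λ x → ¬? (x ∈? A) ×-dec (1 ≤? w′ x)) (proj₁ (∈-before⁻ V K {PriorityKey.key K x} q)))) (w′≤w₁ z))

        σ′ = bid σ (G₂ , G₁)

        sum′ : ∀ x → Lower.w′ σ x + Raise.w′ σ x ≡ L ⊎ Lower.w′ σ x + Raise.w′ σ x ≡ suc L
        sum′ x = by-cases (x ∈? D₁) (x ∈? D₂)
          where
          by-cases : Dec (x ∈ D₁) → Dec (x ∈ D₂) →
            Lower.w′ σ x + Raise.w′ σ x ≡ L ⊎ Lower.w′ σ x + Raise.w′ σ x ≡ suc L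
          by-cases (yes p) (yes q) = ⊥-elim (D₂∌D₁ q p)
          by-cases (yes p) (no q) rewrite raise-off q =
            inj₁ (suc-injective (trans (cong (_+ w₂ x) (lower-on p)) (sum-D₁ p)))
          by-cases (no p) (yes q) rewrite raise-on q | lower-off p =
            inj₂ (trans (+-suc (w₁ x) (w₂ x)) (cong suc (sum-D₂ q)))
          by-cases (no p) (no q) rewrite raise-off q | lower-off p = sum x

        invariant′ : AuctionInvariant σ′
        invariant′ = record
          { basis₁ = lower-level-basis M₁ basis₁ (D⊆S₁ ∘ D₁⊆D) lower-on lower-off (Lower.K σ) greedy₁
          ; basis₂ = raise-level-basis M₂ basis₂ (λ x∈S₂ x∈D₂ → D∌S₂ (D₂⊆D x∈D₂) x∈S₂) raise-on raise-off (Raise.K σ) greedy₂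
          -- The new choice for M₂ lies in `S₂ ∪ D₂`, which contains no lowered bidder and is
          -- therefore kept in `A`.
          ; nested = λ p → ∈-∪ˡ G₁ (case x∈p∪q⁻ S₂ D₂ (IsGreedy.selected-⊆ greedy₂ p) of λ where
              (inj₁ q) → x∈p∧x∉q⇒x∈p─q (nested q) (λ r → D∌S₂ (D₁⊆D r) q)
              (inj₂ q) → x∈p∧x∉q⇒x∈p─q (D⊆S₁ (D₂⊆D q)) (D₂∌D₁ q))
          ; w₁≤L = lower-≤ L D₁ w₁
          ; w₂≤L = raise-≤ L D₂ w₂
          ; sum = sum′
          }

        gain : ∀ x → Raise.w′ σ x + (L ∸ Lower.w′ σ x) ≡ w₂ x + (L ∸ w₁ x) + bit (lookup D x)
        gain x = by-cases (x ∈? D₁) (x ∈? D₂)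
          where
          open ≡-Reasoning
          by-cases : Dec (x ∈ D₁) → Dec (x ∈ D₂) →
            Raise.w′ σ x + (L ∸ Lower.w′ σ x) ≡ w₂ x + (L ∸ w₁ x) + bit (lookup D x)
          by-cases (yes p) (yes q) = ⊥-elim (D₂∌D₁ q p)
          by-cases (no p) (yes q) rewrite raise-on q | lower-off p | ∈-bit (D₂⊆D q) = +-comm 1 _
          by-cases (no p) (no q) rewrite raise-off q | lower-off p
            | ∉-bit {x = x} {U = D} (λ r → p (x∈p∧x∉q⇒x∈p─q r q)) = sym (+-identityʳ _)
          by-cases (yes p) (no q) rewrite raise-off q | ∈-bit (D₁⊆D p) = begin
            w₂ x + (L ∸ Lower.w′ σ x)           ≡⟨ cong (λ k → w₂ x + (k ∸ suc (Lower.w′ σ x))) (+-comm 1 L) ⟩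
            w₂ x + (L + 1 ∸ suc (Lower.w′ σ x)) ≡⟨ cong (λ k → w₂ x + (L + 1 ∸ k)) (lower-on p) ⟩
            w₂ x + (L + 1 ∸ w₁ x)               ≡⟨ cong (w₂ x +_) (+-∸-comm 1 (w₁≤L x)) ⟩
            w₂ x + (L ∸ w₁ x + 1)               ≡⟨ +-assoc (w₂ x) _ 1 ⟨
            w₂ x + (L ∸ w₁ x) + 1               ∎

        potential′ : potential σ′ ≡ potential σ + δ
        potential′ = begin
          total ⊤ (λ x → Raise.w′ σ x + (L ∸ Lower.w′ σ x))      ≡⟨ total-cong ⊤ (λ {x} _ → gain x) ⟩
          total ⊤ (λ x → w₂ x + (L ∸ w₁ x) + bit (lookup D x))   ≡⟨ total-+ ⊤ (λ x → w₂ x + (L ∸ w₁ x)) _ ⟩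
          potential σ + total ⊤ (bit ∘ lookup D)                 ≡⟨ cong (potential σ +_) (total-bit ⊤ D) ⟩
          potential σ + ∣ ⊤ ∩ D ∣                                ≡⟨ cong (λ X → potential σ + ∣ X ∣) (∩-identityˡ D) ⟩
          potential σ + ∣ D ∣                                    ≡⟨ cong (potential σ +_) (∣firstOf∣ δ (S₁ ─ S₂) enough) ⟩
          potential σ + δ                                        ∎
          where open ≡-Reasoning

        eval-bid : eval O (mapᴾ (bid σ) (both (Raise.protocol σ) (Lower.protocol σ))) ≡ σ′
        eval-bid = trans (eval-map O (bid σ) (both (Raise.protocol σ) (Lower.protocol σ)))
          (cong (bid σ) (eval-both O (Raise.protocol σ) (Lower.protocol σ)))

      round-stopped : ∀ σ → unmatched σ < δ → eval O (auctionRound σ) ≡ σ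
      round-stopped σ stop = trans
        (cong (λ b → eval O (bidIf b σ)) (dec-false (δ ≤? unmatched σ) (<⇒≱ stop)))
        (eval-idle O (T * 1 + 1) σ)

      rounds-stopped : ∀ N σ → unmatched σ < δ → afterRounds N σ ≡ σ
      rounds-stopped zero σ stop = refl
      rounds-stopped (suc N) σ stop = trans (eval-iterate O N auctionRound σ)
        (trans (cong (afterRounds N) (round-stopped σ stop)) (rounds-stopped N σ stop))

      round-active : ∀ σ → AuctionInvariant σ → ¬ unmatched σ < δ →
        AuctionInvariant (eval O (auctionRound σ)) × potential (eval O (auctionRound σ)) ≡ potential σ + δ
      round-active σ inv ¬stop = subst (λ τ → AuctionInvariant τ × potential τ ≡ potential σ + δ) (sym round≡) (invariant′ , potential′)
        where
        open BidStep σ inv (≮⇒≥ ¬stop)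
        round≡ : eval O (auctionRound σ) ≡ σ′
        round≡ = trans (cong (λ b → eval O (bidIf b σ)) (dec-true (δ ≤? unmatched σ) (≮⇒≥ ¬stop))) eval-bid

      auction-progress : ∀ N σ → AuctionInvariant σ → AuctionInvariant (afterRounds N σ) ×
        (unmatched (afterRounds N σ) < δ ⊎ potential σ + N * δ ≤ potential (afterRounds N σ))
      auction-progress zero σ inv = inv , inj₂ (≤-reflexive (+-identityʳ _))
      auction-progress (suc N) σ inv with unmatched σ <? δ
      ... | yes stop rewrite rounds-stopped (suc N) σ stop = inv , inj₁ stop
      ... | no ¬stop rewrite eval-iterate O N auctionRound σ with round-active σ inv ¬stop
      ... | inv′ , pot with auction-progress N (eval O (auctionRound σ)) inv′
      ... | inv″ , inj₁ stop = inv″ , inj₁ stop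
      ... | inv″ , inj₂ le = inv″ , inj₂ (≤-trans (≤-reflexive (sym (trans (cong (_+ N * δ) pot) (+-assoc (potential σ) δ (N * δ))))) le)

      auction-stops : ∀ N σ → n * (L + L) < N * δ → AuctionInvariant σ →
        AuctionInvariant (afterRounds N σ) × unmatched (afterRounds N σ) < δ
      auction-stops N σ many inv with auction-progress N σ inv
      ... | inv′ , inj₁ stop = inv′ , stop
      ... | inv′ , inj₂ le = contradiction
        (≤-trans (m≤n+m (N * δ) (potential σ)) (≤-trans le (potential-bounded inv′))) (<⇒≱ many)

    -- Weak duality, with `m` in the place of n/L: `L * ∣ X ∣` is at most the total weight of `S₁`
    -- and `S₂`. On `S₂` the sums exceed `L` by at most one each, which costs at most `n ≤ L * m`,
    -- and `S₁ ─ S₂` contributes at most `L * δ`.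
    auction-gap : ∀ {σ m} → 1 ≤ L → AuctionInvariant σ → n ≤ L * m → unmatched σ ≤ δ →
      ∀ X → Common M₁ M₂ X → ∣ X ∣ ≤ ∣ Auction.S₂ σ ∣ + (m + δ)
    auction-gap {auction w₁ w₂ S₁ S₂} {m} 1≤L inv n≤ few X (X₁ , X₂) = *-cancelˡ-≤ L ⦃ >-nonZero 1≤L ⦄ (begin
      L * ∣ X ∣                                       ≡⟨ trans (*-comm L ∣ X ∣) (sym (total-const X L)) ⟩
      total X (λ _ → L)                               ≤⟨ total-mono X (λ {x} _ → L≤ x) ⟩
      total X (λ x → w₁ x + w₂ x)                     ≡⟨ total-+ X w₁ w₂ ⟩
      total X w₁ + total X w₂                         ≤⟨ +-mono-≤ (level-basis-heaviest M₁ w₁≤L basis₁ X₁) (level-basis-heaviest M₂ w₂≤L basis₂ X₂) ⟩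
      total S₁ w₁ + total S₂ w₂                       ≡⟨ cong (_+ total S₂ w₂) (trans (total-split S₁ S₂ w₁) (cong (λ Y → total Y w₁ + total (S₁ ─ S₂) w₁) S₁∩S₂)) ⟩
      total S₂ w₁ + rest + total S₂ w₂                ≡⟨ trans (+-assoc (total S₂ w₁) rest _) (trans (cong (total S₂ w₁ +_) (+-comm rest _)) (sym (+-assoc (total S₂ w₁) _ rest))) ⟩
      total S₂ w₁ + total S₂ w₂ + rest                ≡⟨ cong (_+ rest) (total-+ S₂ w₁ w₂) ⟨
      total S₂ (λ x → w₁ x + w₂ x) + rest             ≤⟨ +-mono-≤ (total-mono S₂ (λ {x} _ → ≤L+1 x)) (total-mono (S₁ ─ S₂) (λ {x} _ → w₁≤L x)) ⟩
      total S₂ (λ _ → suc L) + total (S₁ ─ S₂) (λ _ → L) ≡⟨ cong₂ _+_ (total-const S₂ (suc L)) (total-const (S₁ ─ S₂) L) ⟩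
      ∣ S₂ ∣ * suc L + ∣ S₁ ─ S₂ ∣ * L                ≡⟨ cong₂ _+_ (trans (*-suc ∣ S₂ ∣ L) (trans (+-comm ∣ S₂ ∣ _) (cong (_+ ∣ S₂ ∣) (*-comm ∣ S₂ ∣ L)))) (*-comm ∣ S₁ ─ S₂ ∣ L) ⟩
      L * ∣ S₂ ∣ + ∣ S₂ ∣ + L * ∣ S₁ ─ S₂ ∣           ≤⟨ +-mono-≤ (+-monoʳ-≤ (L * ∣ S₂ ∣) (≤-trans (∣p∣≤n S₂) n≤)) (*-monoʳ-≤ L few) ⟩
      L * ∣ S₂ ∣ + L * m + L * δ                      ≡⟨ trans (+-assoc (L * ∣ S₂ ∣) _ _) (cong (L * ∣ S₂ ∣ +_) (sym (*-distribˡ-+ L m δ))) ⟩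
      L * ∣ S₂ ∣ + L * (m + δ)                        ≡⟨ *-distribˡ-+ L ∣ S₂ ∣ (m + δ) ⟨
      L * (∣ S₂ ∣ + (m + δ))                          ∎)
      where
      open ≤-Reasoning
      open AuctionInvariant inv
      rest = total (S₁ ─ S₂) w₁
      S₁∩S₂ : S₁ ∩ S₂ ≡ S₂
      S₁∩S₂ = ⊆-antisym (p∩q⊆q S₁ S₂) (λ p → x∈p∩q⁺ (nested p , p))
      L≤ : ∀ x → L ≤ w₁ x + w₂ x
      L≤ x with sum x
      ... | inj₁ eq = ≤-reflexive (sym eq)
      ... | inj₂ eq = ≤-trans (n≤1+n L) (≤-reflexive (sym eq))
      ≤L+1 : ∀ x → w₁ x + w₂ x ≤ suc L
      ≤L+1 x with sum x
      ... | inj₁ eq = ≤-trans (≤-reflexive eq) (n≤1+n L)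
      ... | inj₂ eq = ≤-reflexive eq

    start-invariant : ∀ {B} → 1 ≤ L → IsBasis M₁ ⊤ B → AuctionInvariant (start L B)
    start-invariant {B} 1≤L β = record
      { basis₁ = record
        { level-independent = independent β
        ; positive = λ _ → 1≤L
        ; spanning = λ x∉B _ → dependent-⊇ M₁
            (insert-mono λ p → x∈p∩q⁺ (p , ∈-level⁺ (λ _ → L) ≤-refl)) (maximal β ∈⊤ x∉B)
        }
      ; basis₂ = record
        { level-independent = indep-∅ M₂
        ; positive = ⊥-elim ∘ ∉⊥
        ; spanning = λ _ ()
        }
      ; nested = ⊥-elim ∘ ∉⊥
      ; w₁≤L = λ _ → ≤-refl
      ; w₂≤L = λ _ → z≤n
      ; sum = λ _ → inj₁ (+-identityʳ L)
      }

-- The intersection algorithm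

graphQueries : ℕ → ℕ
graphQueries n = n * 1 + (n * 1 + n * (n * 1))

terminals : Bool → Subset n → Protocol n (n * 1) (Subset n) 1
terminals b S = parallel λ v → mapᴾ (terminalBit S v) (query (b , ⁅ v ⁆ ∪ S))

edgeRow : Subset n → Fin n → Protocol n (n * 1) (Subset n) 1
edgeRow S u = parallel λ v → mapᴾ (edgeBit S u v) (query (edgeQuery S u v))

augmentGraph : Subset n → Subset n × Subset n × Vec (Subset n) n → Subset n
augmentGraph S (sources , sinks , successors) = augmentWith S (exchangeGraph sources sinks successors)

augmentation : Subset n → Protocol n (graphQueries n) (Subset n) 1
augmentation S = mapᴾ (augmentGraph S) (both (terminals false S) (both (terminals true S) (parallel (edgeRow S))))

eval-parallel-query : ∀ {m} (O : Oracle n) (f : Fin m → Bool → Bool) (q : Fin m → Query n) →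
  eval O (parallel (λ v → mapᴾ (f v) (query (q v)))) ≡ tabulate (λ v → f v (O (q v)))
eval-parallel-query O f q = trans (eval-parallel O (λ v → mapᴾ (f v) (query (q v))))
  (tabulate-cong λ v → eval-map O (f v) (query (q v)))

eval-augmentation : ∀ (O : Oracle n) S → eval O (augmentation S) ≡ augmentWith S (graphOf O S)
eval-augmentation O S = trans (eval-map O (augmentGraph S) (both (terminals false S) _))
  (cong (augmentGraph S) (trans (eval-both O (terminals false S) _)
    (cong₂ _,_ (eval-parallel-query O _ _) (trans (eval-both O (terminals true S) _)
      (cong₂ _,_ (eval-parallel-query O _ _) (trans (eval-parallel O (edgeRow S))
        (tabulate-cong λ u → eval-parallel-query O _ _)))))))

module _ (M₁ M₂ : Matroid n) where

  private
    O = ask M₁ M₂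

  -- `k` is only an upper bound on the deficit. Once the set is maximum the remaining rounds keep it
  -- so, and their number can be fixed in advance.
  augmentations-maximum : ∀ {Q} (le : graphQueries n ≤ Q) k S → Common M₁ M₂ S →
    (∀ X → Common M₁ M₂ X → ∣ X ∣ ≤ ∣ S ∣ + k) →
    IsMaxCommon M₁ M₂ (eval O (iterate k (weaken le ∘ augmentation) S))
  augmentations-maximum le zero S (S₁ , S₂) gap =
    S₁ , S₂ , λ X X₁ X₂ → ≤-trans (gap X (X₁ , X₂)) (≤-reflexive (+-identityʳ _))
  augmentations-maximum le (suc k) S common gap
    rewrite eval-iterate O k (weaken le ∘ augmentation) S | eval-weaken O le (augmentation S) | eval-augmentation O S
    with augment-correct M₁ M₂ S common
  ... | common′ , inj₁ size = augmentations-maximum le k _ common′ λ X X∈ →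
    ≤-trans (gap X X∈) (≤-reflexive (trans (+-suc _ k) (cong (_+ k) (sym size))))
  ... | common′ , inj₂ (size , max) = augmentations-maximum le k _ common′ λ X X∈ →
    ≤-trans (max X X∈) (≤-trans size (m≤m+n _ k))

module Intersection (n t h : ℕ) where

  -- Runs have length `s`, and `s * s` is `δ`, so a completion in a batch has at most `s` growing
  -- rounds. The first basis starts from the empty set and may need up to `t ^ 2 * t ^ 3` elements,
  -- hence the summand `t ^ 3`. `N` exceeds 2nt/δ, and `m` adds up `δ` and the bound `t ^ 4` on n/t.
  s δ T T₀ N m Q R : ℕ
  s = t ^ 2
  δ = t ^ 4
  T = 2 * s * h + s
  T₀ = 2 * s * h + t ^ 3
  N = suc (s + s)
  m = δ + δ

  Q = suc (n * n) + ((n * suc (n * n) + n * suc (n * n)) + graphQueries n)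
  R = T₀ * 1 + (N * (T * 1 + 1) + m * 1)

  basis-fits : suc (n * n) ≤ Q
  basis-fits = m≤m+n _ _

  round-fits : n * suc (n * n) + n * suc (n * n) ≤ Q
  round-fits = ≤-trans (m≤m+n _ (graphQueries n)) (m≤n+m _ (suc (n * n)))

  graph-fits : graphQueries n ≤ Q
  graph-fits = ≤-trans (m≤n+m _ (n * suc (n * n) + n * suc (n * n))) (m≤n+m _ (suc (n * n)))

  firstBasis : Protocol n Q (Subset n) (T₀ * 1)
  firstBasis = weaken basis-fits (completion false s T₀ ⊥ ⊤)

  nextRound : Auction n → Protocol n Q (Auction n) (T * 1 + 1)
  nextRound σ = weaken round-fits (auctionRound t δ s T σ)

  improve : Subset n → Protocol n Q (Subset n) (m * 1)
  improve = iterate m (weaken graph-fits ∘ augmentation)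

  improveAuction : Auction n → Protocol n Q (Subset n) (m * 1)
  improveAuction σ = improve (Auction.S₂ σ)

  fromBasis : Subset n → Protocol n Q (Subset n) (N * (T * 1 + 1) + m * 1)
  fromBasis B = bind (iterate N nextRound (start t B)) improveAuction

  intersection : Protocol n Q (Subset n) R
  intersection = bind firstBasis fromBasis

  module _ (M₁ M₂ : Matroid n) (1≤t : 1 ≤ t) (n<t^5 : n < t ^ 5) (n<2^h : n < 2 ^ h) where

    private
      O = ask M₁ M₂

    1≤t^ : ∀ k → 1 ≤ t ^ k
    1≤t^ k = subst (_≤ t ^ k) (^-zeroˡ k) (^-monoˡ-≤ k 1≤t)

    eval-nextRounds : ∀ N σ → eval O (iterate N nextRound σ) ≡ eval O (iterate N (auctionRound t δ s T) σ)
    eval-nextRounds zero σ = refl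
    eval-nextRounds (suc N) σ = begin
      eval O (iterate (suc N) nextRound σ)                                        ≡⟨ eval-iterate O N nextRound σ ⟩
      eval O (iterate N nextRound (eval O (nextRound σ)))                         ≡⟨ cong (λ τ → eval O (iterate N nextRound τ)) (eval-weaken O round-fits (auctionRound t δ s T σ)) ⟩
      eval O (iterate N nextRound (eval O (auctionRound t δ s T σ)))              ≡⟨ eval-nextRounds N _ ⟩
      eval O (iterate N (auctionRound t δ s T) (eval O (auctionRound t δ s T σ))) ≡⟨ eval-iterate O N (auctionRound t δ s T) σ ⟨
      eval O (iterate (suc N) (auctionRound t δ s T) σ)                           ∎
      where open ≡-Reasoning

    B : Subset n
    B = eval O firstBasis

    σ : Auction n
    σ = eval O (iterate N nextRound (start t B))

    eval-intersection : eval O intersection ≡ eval O (improveAuction σ)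
    eval-intersection = trans (eval-bind O firstBasis fromBasis) (eval-bind O (iterate N nextRound (start t B)) improveAuction)

    n≤ : n ≤ t ^ 2 * t ^ 3
    n≤ = ≤-trans (<⇒≤ n<t^5) (≤-reflexive (^-distribˡ-+-* t 2 3))

    B-basis : IsBasis M₁ ⊤ B
    B-basis = subst₂ᴮ (∪-identityˡ ⊤) (sym (eval-weaken O basis-fits (completion false s T₀ ⊥ ⊤)))
      (completion-basis M₁ O false (λ _ → refl) (1≤t^ 2) n<2^h ≤-refl (indep-∅ M₁)
        (λ {J} _ _ → ≤-trans (∣p∣≤n J) (≤-trans n≤ (m≤n+m _ ∣ ⊥ {n} ∣))))
      where
      subst₂ᴮ : ∀ {X Y C D} → X ≡ Y → C ≡ D → IsBasis M₁ X C → IsBasis M₁ Y D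
      subst₂ᴮ refl refl β = β

    many : n * (t + t) < N * δ
    many = begin-strict
      n * (t + t)               ≤⟨ *-monoˡ-≤ (t + t) (<⇒≤ n<t^5) ⟩
      t ^ 5 * (t + t)           ≡⟨ *-distribˡ-+ (t ^ 5) t t ⟩
      t ^ 5 * t + t ^ 5 * t     ≡⟨ cong (λ k → k + k) (trans (*-comm (t ^ 5) t) (^-distribˡ-+-* t 2 4)) ⟩
      s * δ + s * δ             ≡⟨ *-distribʳ-+ δ s s ⟨
      (s + s) * δ               <⟨ m<n+m ((s + s) * δ) (1≤t^ 4) ⟩
      N * δ                     ∎
      where open ≤-Reasoning

    Good : Auction n → Set
    Good τ = AuctionInvariant t δ s T M₁ M₂ τ × unmatched τ < δ

    σ-good : Good σ
    σ-good = subst Good (sym (eval-nextRounds N (start t B)))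
      (auction-stops t δ s T M₁ M₂ {h} {s} (1≤t^ 2) n<2^h ≤-refl (≤-reflexive (^-distribˡ-+-* t 2 2)) N (start t B) many
        (start-invariant t δ s T M₁ M₂ 1≤t B-basis))

    improve-correct : ∀ τ → Good τ → IsMaxCommon M₁ M₂ (eval O (improveAuction τ))
    improve-correct τ (inv , few) = augmentations-maximum M₁ M₂ graph-fits m (Auction.S₂ τ)
      (indep-⊆ M₁ nested (level-independent basis₁) , level-independent basis₂)
      (auction-gap t δ s T M₁ M₂ {τ} {δ} 1≤t inv (<⇒≤ n<t^5) (<⇒≤ few))
      where open AuctionInvariant inv

    intersection-correct : IsMaxCommon M₁ M₂ (eval O intersection)
    intersection-correct = subst (IsMaxCommon M₁ M₂) (sym eval-intersection) (improve-correct σ σ-good)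

-- Arithmetic of the round and query bounds

^-distribʳ-* : ∀ k a b → (a * b) ^ k ≡ a ^ k * b ^ k
^-distribʳ-* zero a b = refl
^-distribʳ-* (suc k) a b = trans (cong (a * b *_) (^-distribʳ-* k a b)) ([m*n]*[o*p]≡[m*o]*[n*p] a b (a ^ k) (b ^ k))

-- The root moves from `t` to `suc t` only when `t ^ 5` has been reached; since `suc t` is at most
-- `2 * t`, this costs the factor `2 ^ 5`.
fifth-root : ∀ n → ∃ λ t → 1 ≤ t × n < t ^ 5 × t ^ 5 ≤ 2 ^ 5 * suc n
fifth-root zero = 1 , s≤s z≤n , s≤s z≤n , s≤s z≤n
fifth-root (suc n) with fifth-root n
... | t , 1≤t , n<t^5 , t^5≤ with suc n <? t ^ 5
... | yes lt = t , 1≤t , lt , ≤-trans t^5≤ (*-monoʳ-≤ (2 ^ 5) (n≤1+n (suc n)))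
... | no ≮ = suc t , s≤s z≤n , ≤-<-trans n<t^5 (^-monoˡ-< 5 (n<1+n t)) , (begin
    suc t ^ 5               ≤⟨ ^-monoˡ-≤ 5 (≤-trans (+-monoˡ-≤ t 1≤t) (≤-reflexive (cong (t +_) (sym (+-identityʳ t))))) ⟩
    (2 * t) ^ 5             ≡⟨ ^-distribʳ-* 5 2 t ⟩
    2 ^ 5 * t ^ 5           ≤⟨ *-monoʳ-≤ (2 ^ 5) (≤-trans (≮⇒≥ ≮) (n≤1+n (suc n))) ⟩
    2 ^ 5 * suc (suc n)     ∎)
  where open ≤-Reasoning

n<2^suc-log : ∀ n → n < 2 ^ suc ⌊log₂ n ⌋
n<2^suc-log n = ≰⇒> λ le → 1+n≰n
  (subst (_≤ ⌊log₂ n ⌋) (⌊log₂[2^n]⌋≡n (suc ⌊log₂ n ⌋)) (⌊log₂⌋-mono-≤ le))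

-- In units of `t ^ 4 * h` the first basis costs 3 and the augmentations 2. At most `3 * s` batches
-- of at most `4 * (s * h)` rounds cost 12.
rounds-bound : ∀ n {t h} → 1 ≤ t → 1 ≤ h → Intersection.R n t h ≤ 17 * t ^ 4 * h
rounds-bound n {t} {h} 1≤t 1≤h = begin
  T₀ * 1 + (N * (T * 1 + 1) + m * 1)      ≡⟨ cong₂ _+_ (*-identityʳ T₀) (cong₂ _+_ (cong (λ k → N * (k + 1)) (*-identityʳ T)) (*-identityʳ m)) ⟩
  T₀ + (N * (T + 1) + m)                  ≤⟨ +-mono-≤ T₀≤ (+-mono-≤ rounds≤ m≤) ⟩
  3 * X + (12 * X + 2 * X)                ≡⟨ cong (3 * X +_) (*-distribʳ-+ X 12 2) ⟨
  3 * X + 14 * X                          ≡⟨ *-distribʳ-+ X 3 14 ⟨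
  17 * X                                  ≡⟨ *-assoc 17 δ h ⟨
  17 * δ * h                              ∎
  where
  open Intersection n t h using (T₀; N; T; m; δ; s)
  open ≤-Reasoning
  X = δ * h

  pos : ∀ k → 1 ≤ t ^ k
  pos k = subst (_≤ t ^ k) (^-zeroˡ k) (^-monoˡ-≤ k 1≤t)

  ≤X : ∀ {a} → a ≤ δ → a ≤ X
  ≤X {a} a≤δ = ≤-trans a≤δ (m≤m*n δ h ⦃ >-nonZero 1≤h ⦄)

  s≤δ : s ≤ δ
  s≤δ = ^-monoʳ-≤ t ⦃ >-nonZero 1≤t ⦄ (m≤m+n 2 2)

  T₀≤ : T₀ ≤ 3 * X
  T₀≤ = begin
    2 * s * h + t ^ 3 ≡⟨ cong (_+ t ^ 3) (*-assoc 2 s h) ⟩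
    2 * (s * h) + t ^ 3 ≤⟨ +-mono-≤ (*-monoʳ-≤ 2 (*-monoˡ-≤ h s≤δ)) (≤X (^-monoʳ-≤ t ⦃ >-nonZero 1≤t ⦄ (n≤1+n 3))) ⟩
    2 * X + X ≡⟨ +-comm (2 * X) X ⟩
    3 * X ∎

  m≤ : m ≤ 2 * X
  m≤ = ≤-trans (+-mono-≤ (≤X ≤-refl) (≤X ≤-refl)) (≤-reflexive (cong (X +_) (sym (+-identityʳ X))))

  T+1≤ : T + 1 ≤ 4 * (s * h)
  T+1≤ = begin
    2 * s * h + s + 1 ≡⟨ cong (λ k → k + s + 1) (*-assoc 2 s h) ⟩
    2 * Y + s + 1     ≤⟨ +-mono-≤ (+-monoʳ-≤ (2 * Y) s≤Y) (≤-trans (pos 2) s≤Y) ⟩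
    2 * Y + Y + Y     ≡⟨ cong (_+ Y) (+-comm (2 * Y) Y) ⟩
    3 * Y + Y         ≡⟨ +-comm (3 * Y) Y ⟩
    4 * Y             ∎
    where
    Y = s * h
    s≤Y : s ≤ Y
    s≤Y = m≤m*n s h ⦃ >-nonZero 1≤h ⦄

  rounds≤ : N * (T + 1) ≤ 12 * X
  rounds≤ = begin
    N * (T + 1)           ≤⟨ *-mono-≤ N≤ T+1≤ ⟩
    3 * s * (4 * (s * h)) ≡⟨ [m*n]*[o*p]≡[m*o]*[n*p] 3 s 4 (s * h) ⟩
    12 * (s * (s * h))    ≡⟨ cong (12 *_) (trans (sym (*-assoc s s h)) (cong (_* h) (sym (^-distribˡ-+-* t 2 2)))) ⟩
    12 * X                ∎
    where
    N≤ : N ≤ 3 * s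
    N≤ = ≤-trans (+-monoˡ-≤ (s + s) (pos 2)) (≤-reflexive (cong (λ k → s + (s + k)) (sym (+-identityʳ s))))

roundsConstant : ℕ → ℕ → ℕ
roundsConstant a b = a ^ 21 * b ^ 17

rounds-power : ∀ {R t h} a b {c C} → roundsConstant a b ≤ C → 1 ≤ t → R ≤ a * t ^ 4 * h → t ^ 5 ≤ b * c →
               R ^ 21 ≤ C * c ^ 17 * h ^ 21
rounds-power {R} {t} {h} a b {c} {C} ≤C 1≤t R≤ t^5≤ = begin
  R ^ 21                               ≤⟨ ^-monoˡ-≤ 21 R≤ ⟩
  (a * t ^ 4 * h) ^ 21                 ≡⟨ ^-distribʳ-* 21 (a * t ^ 4) h ⟩
  (a * t ^ 4) ^ 21 * h ^ 21            ≡⟨ cong (_* h ^ 21) (^-distribʳ-* 21 a (t ^ 4)) ⟩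
  a ^ 21 * (t ^ 4) ^ 21 * h ^ 21       ≤⟨ *-monoˡ-≤ (h ^ 21) (*-monoʳ-≤ (a ^ 21) t^84≤) ⟩
  a ^ 21 * (b ^ 17 * c ^ 17) * h ^ 21  ≡⟨ cong (_* h ^ 21) (*-assoc (a ^ 21) (b ^ 17) (c ^ 17)) ⟨
  a ^ 21 * b ^ 17 * c ^ 17 * h ^ 21    ≤⟨ *-monoˡ-≤ (h ^ 21) (*-monoˡ-≤ (c ^ 17) ≤C) ⟩
  C * c ^ 17 * h ^ 21                  ∎
  where
  open ≤-Reasoning
  t^84≤ : (t ^ 4) ^ 21 ≤ b ^ 17 * c ^ 17
  t^84≤ = begin
    (t ^ 4) ^ 21      ≡⟨ ^-*-assoc t 4 21 ⟩
    -- The slack between the exponents 4/5 and 17/21: 4 times 21 is 84, while 5 times 17 is 85.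
    t ^ 84            ≤⟨ ^-monoʳ-≤ t ⦃ >-nonZero 1≤t ⦄ (n≤1+n 84) ⟩
    t ^ 85            ≡⟨ ^-*-assoc t 5 17 ⟨
    (t ^ 5) ^ 17      ≤⟨ ^-monoˡ-≤ 17 t^5≤ ⟩
    (b * c) ^ 17      ≡⟨ ^-distribʳ-* 17 b c ⟩
    b ^ 17 * c ^ 17   ∎

queries-bound : ∀ n t h → Intersection.Q n t h ≤ 6 * suc n ^ 3
queries-bound n t h = begin
  suc (n * n) + ((n * suc (n * n) + n * suc (n * n)) + (n * 1 + (n * 1 + n * (n * 1))))
    ≤⟨ +-mono-≤ A (+-mono-≤ (+-mono-≤ B B) (+-mono-≤ C (+-mono-≤ C D))) ⟩
  X + ((X + X) + (X + (X + X)))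
    ≡⟨ cong (X +_) (trans (+-assoc X X _) (cong (λ k → X + (X + (X + (X + k)))) (sym (+-identityʳ X)))) ⟩
  6 * X ∎
  where
  open ≤-Reasoning
  X = suc n ^ 3
  n≤ : n ≤ suc n
  n≤ = n≤1+n n
  square : suc (n * n) ≤ suc n ^ 2
  square = s≤s (≤-trans (*-monoʳ-≤ n (≤-trans n≤ (≤-reflexive (sym (*-identityʳ (suc n)))))) (m≤n+m _ _))
  A : suc (n * n) ≤ X
  A = ≤-trans square (^-monoʳ-≤ (suc n) (n≤1+n 2))
  B : n * suc (n * n) ≤ X
  B = *-mono-≤ n≤ square
  C : n * 1 ≤ X
  C = ≤-trans (*-monoˡ-≤ 1 n≤) (^-monoʳ-≤ (suc n) (s≤s (z≤n {2})))
  D : n * (n * 1) ≤ X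
  D = ≤-trans (*-mono-≤ n≤ (*-monoˡ-≤ 1 n≤)) (^-monoʳ-≤ (suc n) (n≤1+n 2))

-- Without random bits the empty string is the only random string, and it is good.
deterministic-success : ∀ {n Q R} (p : Protocol n Q (Subset n) R) (M₁ M₂ : Matroid n) →
  IsMaxCommon M₁ M₂ (eval (ask M₁ M₂) p) → SucceedsWHP (algorithm p) R M₁ M₂
deterministic-success {n} {R = R} p M₁ M₂ correct =
  [] ∷ [] , [] ∷ [] , subst (IsMaxCommon M₁ M₂) (sym (run-algorithm M₁ M₂ p [])) correct ∷ [] ,
  *-monoˡ-≤ 1 (m∸n≤m n 1)

abstract
  -- The 6 serves the query bound. The other summand is what remains of the 21st power of
  -- `17 * t ^ 4 * h` after inserting `t ^ 5 ≤ 2 ^ 5 * suc n`.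
  constant : ℕ
  constant = 6 + roundsConstant 17 (2 ^ 5)

  6≤constant : 6 ≤ constant
  6≤constant = m≤m+n 6 (roundsConstant 17 (2 ^ 5))

  rounds≤constant : roundsConstant 17 (2 ^ 5) ≤ constant
  rounds≤constant = m≤n+m (roundsConstant 17 (2 ^ 5)) 6

Solves : ℕ → ℕ → Set
Solves n h = ∃ λ R → ∃ λ Q → ∃ λ B → Σ (RoundAlg n Q B) λ A →
  Q ≤ constant * suc n ^ 3 × R ^ 21 ≤ constant * suc n ^ 17 * h ^ 21 ×
  (∀ (M₁ M₂ : Matroid n) → SucceedsWHP A R M₁ M₂)

intersection-solves : ∀ n t h → 1 ≤ t → 1 ≤ h → n < t ^ 5 → t ^ 5 ≤ 2 ^ 5 * suc n → n < 2 ^ h → Solves n h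
intersection-solves n t h 1≤t 1≤h n<t^5 t^5≤ n<2^h =
  Intersection.R n t h , Intersection.Q n t h , 0 , algorithm (Intersection.intersection n t h) ,
  ≤-trans (queries-bound n t h) (*-monoˡ-≤ (suc n ^ 3) 6≤constant) ,
  rounds-power {Intersection.R n t h} {t} {h} 17 (2 ^ 5) {suc n} {constant}
    rounds≤constant 1≤t (rounds-bound n {t} {h} 1≤t 1≤h) t^5≤ ,
  λ M₁ M₂ → deterministic-success (Intersection.intersection n t h) M₁ M₂
    (Intersection.intersection-correct n t h M₁ M₂ 1≤t n<t^5 n<2^h)

theorem1p2 : ∃ λ (C : ℕ) → ∃ λ (d : ℕ) → ∃ λ (k : ℕ) →
    ∀ (n : ℕ) → ∃ λ (R : ℕ) → ∃ λ (Q : ℕ) → ∃ λ (B : ℕ) →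
    Σ (RoundAlg n Q B) λ A →
    Q ≤ C * suc n ^ d ×
    R ^ 21 ≤ C * suc n ^ 17 * suc ⌊log₂ n ⌋ ^ k ×
    (∀ (M₁ M₂ : Matroid n) → SucceedsWHP A R M₁ M₂)
-- The round bound contains a single logarithmic factor; its exponent 21 results from comparing 21st
-- powers.
theorem1p2 = constant , 3 , 21 , λ n →
  let t , 1≤t , n<t^5 , t^5≤ = fifth-root n
  in intersection-solves n t (suc ⌊log₂ n ⌋) 1≤t (s≤s z≤n) n<t^5 t^5≤ (n<2^suc-log n)
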